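{- Let $D=(V,A)$ be a loopless digraph, let $\{S,T\}$ be a partition of $V$ with $S,T\neq\emptyset$, and let $b\in\mathbb{Z}_{++}^V$. Then the maximum number of pairwise disjoint $b$-bibranchings in $D$ equals the minimum of the following three values: $$\min\left\{\left\lfloor \frac{d_A^-(v)}{b(v)}\right\rfloor : v\in T\right\},\qquad \min\left\{\left\lfloor \frac{d_A^+(v)}{b(v)}\right\rfloor : v\in S\right\},\qquad \min\{|C| : C \text{ is a bicut}\}.$$
   Context: For $B\subseteq A$ and $X\subseteq V$, $\delta_B^-(X)$ ($\delta_B^+(X)$) is the set of arcs of $B$ entering (leaving) $X$, $d_B^\pm(X)=|\delta_B^\pm(X)|$, and $d_B^\pm(v)=d_B^\pm(\{v\})$. A bicut is an arc set $\delta_A^-(U)$ for some $U\subseteq V$ with $\emptyset\neq U\subseteq T$ or $T\subseteq U\subsetneq V$. An arc subset $B\subseteq A$ is a $b$-bibranching if (1) every vertex of $T$ is reachable from some vertex of $S$ in the subgraph $(V,B)$; (2) every vertex of $S$ reaches some vertex of $T$ in $(V,B)$; (3) $d_B^-(v)\ge b(v)$ for every $v\in T$; (4) $d_B^+(u)\ge b(u)$ for every $u\in S$. -}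

module Defs where

open import Data.Nat using (ℕ; _≤_; _>_; _/_; >-nonZero)
open import Data.Fin using (Fin)
open import Data.Fin.Subset using (Subset; _∈_; _∉_; _⊆_; _⊂_; ⊤; ∁; ⁅_⁆; ∣_∣; Nonempty; inside)
open import Data.Bool using (Bool; true; false; _∧_; not)
open import Data.Vec using (lookup; tabulate)
open import Data.Product using (Σ; _×_; ∃)
open import Data.Sum using (_⊎_)
open import Data.Empty using (⊥)
open import Relation.Binary.PropositionalEquality using (_≡_; _≢_)

record Digraph : Set where
  field
    n  : ℕ
    m  : ℕ
    tl : Fin m → Fin n
    hd : Fin m → Fin n

module _ (D : Digraph) where
  open Digraph D

  Vertex = Fin n
  Arc    = Fin m
  ArcSet = Subset m
  VSet   = Subset n

  Loopless : Set
  Loopless = ∀ (a : Arc) → tl a ≢ hd a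

  δin : ArcSet → VSet → ArcSet
  δin B X = tabulate λ a → isIn B a ∧ (isIn X (hd a) ∧ not (isIn X (tl a)))
    where
      isIn : ∀ {k} → Subset k → Fin k → Bool
      isIn p x = lookup p x

  δout : ArcSet → VSet → ArcSet
  δout B X = tabulate λ a → lookup B a ∧ (lookup X (tl a) ∧ not (lookup X (hd a)))

  dIn : ArcSet → VSet → ℕ
  dIn B X = ∣ δin B X ∣

  dOut : ArcSet → VSet → ℕ
  dOut B X = ∣ δout B X ∣

  dInV : ArcSet → Vertex → ℕ
  dInV B v = dIn B ⁅ v ⁆

  dOutV : ArcSet → Vertex → ℕ
  dOutV B v = dOut B ⁅ v ⁆

  data Reach (B : ArcSet) : Vertex → Vertex → Set where
    here : ∀ {v} → Reach B v v
    step : ∀ {u v} (a : Arc) → a ∈ B → tl a ≡ u → Reach B (hd a) v → Reach B u v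

  -- The bipartition {S,T} of V is given by S; T is its complement ∁ S.
  -- b-bibranching (conditions (1)-(4) of the paper)
  IsBibranching : (S : VSet) (b : Vertex → ℕ) → ArcSet → Set
  IsBibranching S b B =
      (∀ v → v ∈ ∁ S → ∃ λ u → u ∈ S × Reach B u v)
    × (∀ u → u ∈ S → ∃ λ v → v ∈ ∁ S × Reach B u v)
    × (∀ v → v ∈ ∁ S → b v ≤ dInV B v)
    × (∀ u → u ∈ S → b u ≤ dOutV B u)

  HasDisjointBibranchings : (S : VSet) (b : Vertex → ℕ) → ℕ → Set
  HasDisjointBibranchings S b k =
    Σ (Fin k → ArcSet) λ F →
        (∀ i → IsBibranching S b (F i))
      × (∀ i j → i ≢ j → ∀ a → a ∈ F i → a ∈ F j → ⊥)

  -- U defines a bicut δ_A^-(U): ∅ ≠ U ⊆ T, or T ⊆ U ⊊ V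
  BicutSet : (S : VSet) → VSet → Set
  BicutSet S U = (Nonempty U × U ⊆ ∁ S) ⊎ (∁ S ⊆ U × U ⊂ ⊤)

  floorDiv : (x y : ℕ) → y > 0 → ℕ
  floorDiv x y p = _/_ x y {{>-nonZero p}}

  CandidateValue : (S : VSet) (b : Vertex → ℕ) → (∀ v → b v > 0) → ℕ → Set
  CandidateValue S b bpos k =
      (∃ λ v → v ∈ ∁ S × k ≡ floorDiv (dInV ⊤ v) (b v) (bpos v))
    ⊎ (∃ λ u → u ∈ S × k ≡ floorDiv (dOutV ⊤ u) (b u) (bpos u))
    ⊎ (∃ λ U → BicutSet S U × k ≡ ∣ δin ⊤ U ∣)

IsMinimum : (ℕ → Set) → ℕ → Set
IsMinimum P k = P k × (∀ j → P j → k ≤ j)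

IsMaximum : (ℕ → Set) → ℕ → Set
IsMaximum P k = P k × (∀ j → P j → j ≤ k)

{-# OPTIONS --safe #-}
module Submission where

-- Only the arcs from S to T are shared by the conditions on T and the conditions on S; reversing the
-- digraph turns the latter into the former.  A colouring of these arcs with k colours extends to the
-- arcs inside T such that every colour satisfies the conditions on T iff, for nonempty U ⊆ T, the
-- number of colours missing among the shared arcs entering U is at most the number of inner arcs
-- entering U, and for v ∈ T the same holds for the total degree deficit at v.  This is Edmonds'
-- disjoint branchings theorem, by Lovász's argument, followed by a greedy distribution of the
-- remaining arcs.  It also yields feasible colourings for T and for S separately.
--
-- A feasible colouring φ for T and a feasible colouring φ′ for S are made equal by Kempe changes.
-- For colours i ≠ j there is a matching on the arcs coloured i or j such that any exchange of i and
-- j that makes every matched pair bichromatic stays feasible: pair arcs with a common head, then pair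
-- leftover arcs inside the minimal critical sets, which are disjoint.  If φ and φ′ differ on an arc,
-- with colours i and j there, the union of the two matchings is bipartite, so one two-colouring
-- recolours both φ and φ′, and they disagree on fewer arcs.

open import Defs
open import Data.Nat using (ℕ; zero; suc; _+_; _∸_; _*_; _≤_; _<_; _>_; z≤n; s≤s; s≤s⁻¹; _≤?_; _<?_; >-nonZero)
open import Data.Nat.Properties hiding (_≤?_; _<?_; _≟_; ≡-irrelevant)
open import Data.Nat.DivMod using (m/n*n≤m; m*n/n≡m; /-monoˡ-≤)
open import Data.Nat.Induction using (<-wellFounded)
open import Data.Nat.Solver using (module +-*-Solver)
open import Induction.WellFounded using (Acc; acc)
open import Data.Fin using (Fin; zero; suc) renaming (_≟_ to _≟ᶠ_; _<_ to _<ᶠ_; _<?_ to _<ᶠ?_)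
open import Data.Fin.Properties using (any?) renaming (<-cmp to <ᶠ-cmp; <-asym to <ᶠ-asym)
open import Data.Fin.Subset using (Subset; _∈_; _∉_; _⊆_; _⊂_; _∩_; _∪_; ⊤; ∁; ⁅_⁆; ∣_∣; Nonempty)
open import Data.Fin.Subset.Properties using (_∈?_; _⊆?_; _⊂?_; nonempty?; anySubset?;
  x∈p∩q⁺; x∈p∩q⁻; x∈p∪q⁺; x∈p∪q⁻; x∈⁅x⁆; x∈⁅y⁆⇒x≡y; p⊂q⇒∣p∣<∣q∣; ∈⊤;
  x∈p⇒x∉∁p; x∈∁p⇒x∉p; x∉p⇒x∈∁p; x∉∁p⇒x∈p; p⊆q⇒∁p⊇∁q)
open import Data.Bool using (Bool; true; false; _∧_; _∨_; not; if_then_else_)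
open import Data.Bool.Properties using (not-¬; not-involutive)
open import Data.Maybe using (Maybe; just; nothing; fromMaybe)
open import Data.Maybe.Properties using (just-injective) renaming (≡-dec to ≡-decᵐ)
open import Data.Product using (_×_; ∃; _,_; proj₁; proj₂)
open import Data.Product.Properties using () renaming (≡-dec to ≡-dec×)
open import Data.Sum using (_⊎_; inj₁; inj₂; [_,_]′)
open import Data.Empty using (⊥; ⊥-elim)
open import Data.Vec using (tabulate; lookup)
open import Data.Vec.Properties using (lookup∘tabulate; []=⇒lookup; lookup⇒[]=)
open import Data.List using (List; []; _∷_; _++_; allFin) renaming (tabulate to tabulateˡ)
open import Data.List.Properties using (++-assoc)
open import Data.List.Relation.Unary.All as All using (All; []; _∷_)
open import Data.List.Relation.Unary.All.Properties using (++⁻ˡ)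
open import Data.List.Relation.Unary.Any using (here; there)
open import Data.List.Relation.Unary.AllPairs using (AllPairs; []; _∷_)
open import Data.List.Relation.Unary.Unique.Propositional using (Unique)
open import Data.List.Relation.Unary.Unique.Propositional.Properties using (allFin⁺)
open import Data.List.Membership.Propositional using () renaming (_∈_ to _∈ˡ_)
open import Data.List.Membership.Propositional.Properties using (∈-allFin; ∈-++⁻; ∈-++⁺ˡ; ∈-++⁺ʳ)
open import Data.List.Membership.DecPropositional using () renaming (_∈?_ to mem?)
open import Data.List.Relation.Binary.Permutation.Propositional
  using (_↭_; refl; prep; swap; ↭-sym; ↭⇒↭ₛ) renaming (trans to ↭-trans)
open import Data.List.Relation.Binary.Permutation.Propositional.Properties using (++⁺ˡ; shift; ∈-resp-↭)
import Data.List.Relation.Binary.Permutation.Setoid.Properties as SetoidPerm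
open import Function using (_∘_; id)
open import Relation.Nullary using (¬_; Dec; yes; no; does)
open import Relation.Nullary.Decidable using (_×-dec_; _⊎-dec_; ¬?; decidable-stable; dec-true)
open import Relation.Unary using (Decidable)
open import Relation.Binary using () renaming (Decidable to Decidable₂)
open import Relation.Binary.Definitions using (tri<; tri≈; tri>)
open import Relation.Binary.PropositionalEquality
open import Algebra.Properties.CommutativeMonoid.Sum +-0-commutativeMonoid using (sum; sum-cong-≗; ∑-distrib-+; ∑-comm)

-- Counting

⟦_⟧ : {P : Set} → Dec P → ℕ
⟦ yes _ ⟧ = 1
⟦ no _ ⟧ = 0

module _ {P : Set} where
  ⟦⟧-yes : (p : Dec P) → P → ⟦ p ⟧ ≡ 1
  ⟦⟧-yes (yes _) _ = refl
  ⟦⟧-yes (no ¬p) p = ⊥-elim (¬p p)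

  ⟦⟧-no : (p : Dec P) → ¬ P → ⟦ p ⟧ ≡ 0
  ⟦⟧-no (yes p) ¬p = ⊥-elim (¬p p)
  ⟦⟧-no (no _) _ = refl

  ⟦⟧≤1 : (p : Dec P) → ⟦ p ⟧ ≤ 1
  ⟦⟧≤1 (yes _) = s≤s z≤n
  ⟦⟧≤1 (no _) = z≤n

module _ {P Q : Set} where
  ⟦⟧-mono : (p : Dec P) (q : Dec Q) → (P → Q) → ⟦ p ⟧ ≤ ⟦ q ⟧
  ⟦⟧-mono (no _) q f = z≤n
  ⟦⟧-mono (yes p) q f = ≤-reflexive (sym (⟦⟧-yes q (f p)))

  ⟦⟧-cong : (p : Dec P) (q : Dec Q) → (P → Q) → (Q → P) → ⟦ p ⟧ ≡ ⟦ q ⟧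
  ⟦⟧-cong (no ¬p) q f g = sym (⟦⟧-no q (¬p ∘ g))
  ⟦⟧-cong (yes p) q f g = sym (⟦⟧-yes q (f p))

  ⟦⟧-< : (p : Dec P) (q : Dec Q) → ⟦ p ⟧ < ⟦ q ⟧ → ¬ P × Q
  ⟦⟧-< (yes _) (yes _) (s≤s ())
  ⟦⟧-< (no ¬p) (yes q) _ = ¬p , q

-- The pointwise inequality behind both uncrossing facts, submodularity of `free` and
-- supermodularity of `miss`.
⟦⟧-cross : {A B C D : Set} (a : Dec A) (b : Dec B) (c : Dec C) (d : Dec D) →
           (A → C ⊎ D) → (B → C ⊎ D) → (A → B → C × D) → ⟦ a ⟧ + ⟦ b ⟧ ≤ ⟦ c ⟧ + ⟦ d ⟧
⟦⟧-cross (no _) (no _) c d f g h = z≤n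
⟦⟧-cross (yes a) (yes b) c d f g h =
  ≤-reflexive (cong₂ _+_ (sym (⟦⟧-yes c (proj₁ (h a b)))) (sym (⟦⟧-yes d (proj₂ (h a b)))))
⟦⟧-cross (yes a) (no _) c d f g h with f a
... | inj₁ x = ≤-trans (≤-reflexive (sym (⟦⟧-yes c x))) (m≤m+n _ _)
... | inj₂ y = ≤-trans (≤-reflexive (sym (⟦⟧-yes d y))) (m≤n+m _ _)
⟦⟧-cross (no _) (yes b) c d f g h with g b
... | inj₁ x = ≤-trans (≤-reflexive (sym (⟦⟧-yes c x))) (m≤m+n _ _)
... | inj₂ y = ≤-trans (≤-reflexive (sym (⟦⟧-yes d y))) (m≤n+m _ _)

# : ∀ {n} {P : Fin n → Set} → Decidable P → ℕ
# P? = sum (λ i → ⟦ P? i ⟧)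

∑-mono : ∀ {n} {f g : Fin n → ℕ} → (∀ i → f i ≤ g i) → sum f ≤ sum g
∑-mono {zero} h = z≤n
∑-mono {suc n} h = +-mono-≤ (h zero) (∑-mono (h ∘ suc))

∑-mono-< : ∀ {n} {f g : Fin n → ℕ} → (∀ i → f i ≤ g i) → ∀ j → f j < g j → sum f < sum g
∑-mono-< h zero l = +-mono-<-≤ l (∑-mono (h ∘ suc))
∑-mono-< h (suc j) l = +-mono-≤-< (h zero) (∑-mono-< (h ∘ suc) j l)

∑-mono₂ : ∀ {n} {f g h l : Fin n → ℕ} → (∀ i → f i + g i ≤ h i + l i) → sum f + sum g ≤ sum h + sum l
∑-mono₂ {f = f} {g} {h} {l} le =
  subst₂ _≤_ (∑-distrib-+ f g) (∑-distrib-+ h l) (∑-mono le)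

∑-mono₂-< : ∀ {n} {f g h l : Fin n → ℕ} → (∀ i → f i + g i ≤ h i + l i) →
            ∀ j → f j + g j < h j + l j → sum f + sum g < sum h + sum l
∑-mono₂-< {f = f} {g} {h} {l} le j lt =
  subst₂ _<_ (∑-distrib-+ f g) (∑-distrib-+ h l) (∑-mono-< le j lt)

∑-<⇒∃ : ∀ {n} (f g : Fin n → ℕ) → sum f < sum g → ∃ λ i → f i < g i
∑-<⇒∃ {zero} f g ()
∑-<⇒∃ {suc n} f g lt with g zero ≤? f zero
... | no g≰f = zero , ≰⇒> g≰f
... | yes g≤f with ∑-<⇒∃ (f ∘ suc) (g ∘ suc) (+-cancelˡ-≤ (f zero) _ _ (begin
        f zero + suc (sum (f ∘ suc)) ≡⟨ solve 2 (λ x y → x :+ (con 1 :+ y) := con 1 :+ (x :+ y)) refl (f zero) _ ⟩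
        suc (sum f)                  ≤⟨ lt ⟩
        g zero + sum (g ∘ suc)       ≤⟨ +-mono-≤ g≤f ≤-refl ⟩
        f zero + sum (g ∘ suc)       ∎))
  where open ≤-Reasoning
        open +-*-Solver
... | i , l = suc i , l

∑-update : ∀ {n} {f g : Fin n → ℕ} {δ} a → (∀ e → e ≢ a → f e ≡ g e) → f a ≡ g a + δ →
           sum f ≡ sum g + δ
∑-update {f = f} {g} {δ} zero h eq = begin
  f zero + sum (f ∘ suc)       ≡⟨ cong₂ _+_ eq (sum-cong-≗ (λ i → h (suc i) λ ())) ⟩
  (g zero + δ) + sum (g ∘ suc) ≡⟨ solve 3 (λ x y z → (x :+ y) :+ z := (x :+ z) :+ y) refl (g zero) δ _ ⟩
  (g zero + sum (g ∘ suc)) + δ ∎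
  where open ≡-Reasoning
        open +-*-Solver
∑-update {f = f} {g} {δ} (suc a) h eq = begin
  f zero + sum (f ∘ suc)       ≡⟨ cong₂ _+_ (h zero λ ()) (∑-update a (λ e ne → h (suc e) (λ { refl → ne refl })) eq) ⟩
  g zero + (sum (g ∘ suc) + δ) ≡⟨ sym (+-assoc (g zero) _ δ) ⟩
  (g zero + sum (g ∘ suc)) + δ ∎
  where open ≡-Reasoning

∑-term≤ : ∀ {n} (f : Fin n → ℕ) i → f i ≤ sum f
∑-term≤ f zero = m≤m+n _ _
∑-term≤ f (suc i) = ≤-trans (∑-term≤ (f ∘ suc) i) (m≤n+m _ _)

∑-zero : ∀ {n} (f : Fin n → ℕ) → (∀ i → f i ≡ 0) → sum f ≡ 0
∑-zero {zero} f h = refl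
∑-zero {suc n} f h = cong₂ _+_ (h zero) (∑-zero (f ∘ suc) (h ∘ suc))

∑-const : ∀ n c → sum {n} (λ _ → c) ≡ n * c
∑-const zero c = refl
∑-const (suc n) c = cong (c +_) (∑-const n c)

#-pos : ∀ {n} {P : Fin n → Set} (P? : Decidable P) → 0 < # P? → ∃ P
#-pos {suc n} P? pos with P? zero
... | yes p = zero , p
... | no _ with #-pos (P? ∘ suc) pos
... | i , p = suc i , p

#-one : ∀ {n} {P : Fin n → Set} (P? : Decidable P) → (∀ i j → P i → P j → i ≡ j) → # P? ≤ 1
#-one {zero} P? u = z≤n
#-one {suc n} P? u with P? zero
... | no _ = #-one (P? ∘ suc) λ i j p q → fsuc (u _ _ p q)
  where fsuc : ∀ {n} {i j : Fin n} → Fin.suc i ≡ suc j → i ≡ j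
        fsuc refl = refl
... | yes p = ≤-reflexive (cong suc (∑-zero _ (λ i → ⟦⟧-no (P? (suc i)) (λ q → absurd (u _ _ p q)))))
  where absurd : ∀ {n} {i : Fin n} → Fin.zero ≢ suc i
        absurd ()

-- Zeroing the two terms instead of deleting them keeps the index type, so sums over all colours can
-- be compared termwise away from the two exchanged colours.
rest : ∀ {n} → Fin n → Fin n → (Fin n → ℕ) → Fin n → ℕ
rest i j f c = if does (c ≟ᶠ i) ∨ does (c ≟ᶠ j) then 0 else f c

rest-other : ∀ {n} {i j c : Fin n} f → c ≢ i → c ≢ j → rest i j f c ≡ f c
rest-other {i = i} {j} {c} f ni nj with c ≟ᶠ i | c ≟ᶠ j
... | yes p | _ = ⊥-elim (ni p)
... | no _ | yes p = ⊥-elim (nj p)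
... | no _ | no _ = refl

rest-cong : ∀ {n} {i j : Fin n} {f g : Fin n → ℕ} → (∀ c → c ≢ i → c ≢ j → f c ≡ g c) →
            ∀ c → rest i j f c ≡ rest i j g c
rest-cong {i = i} {j} h c with c ≟ᶠ i | c ≟ᶠ j
... | yes _ | _ = refl
... | no _ | yes _ = refl
... | no ni | no nj = h c ni nj

rest-mono₂ : ∀ {n} {i j : Fin n} {f g h l : Fin n → ℕ} → (∀ c → f c + g c ≤ h c + l c) →
             ∀ c → rest i j f c + rest i j g c ≤ rest i j h c + rest i j l c
rest-mono₂ {i = i} {j} le c with does (c ≟ᶠ i) ∨ does (c ≟ᶠ j)
... | true = z≤n
... | false = le c

∑-rest : ∀ {n} {i j : Fin n} (f : Fin n → ℕ) → i ≢ j → sum f ≡ sum (rest i j f) + (f i + f j)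
∑-rest {i = i} {j} f i≢j = begin
  sum f                            ≡⟨ ∑-update j offj atj ⟩
  sum g + f j                      ≡⟨ cong (_+ f j) (∑-update i offi ati) ⟩
  (sum (rest i j f) + f i) + f j   ≡⟨ +-assoc _ (f i) (f j) ⟩
  sum (rest i j f) + (f i + f j)   ∎
  where
  open ≡-Reasoning
  -- `rest j j` drops only the term at `j`, so the two terms come off one at a time.
  g : Fin _ → ℕ
  g = rest j j f
  offj : ∀ e → e ≢ j → f e ≡ g e
  offj e ne = sym (rest-other f ne ne)
  atj : f j ≡ g j + f j
  atj with j ≟ᶠ j
  ... | yes _ = refl
  ... | no ne = ⊥-elim (ne refl)
  offi : ∀ e → e ≢ i → g e ≡ rest i j f e
  offi e ne with e ≟ᶠ i | e ≟ᶠ j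
  ... | yes p | _ = ⊥-elim (ne p)
  ... | no _ | yes _ = refl
  ... | no _ | no _ = refl
  ati : g i ≡ rest i j f i + f i
  ati with i ≟ᶠ i | i ≟ᶠ j
  ... | yes _ | yes p = ⊥-elim (i≢j p)
  ... | yes _ | no _ = refl
  ... | no ne | _ = ⊥-elim (ne refl)

-- Pairings and two-colourings

flat : {A : Set} → List (A × A) → List A
flat [] = []
flat ((x , y) ∷ P) = x ∷ y ∷ flat P

flat-++ : {A : Set} (P Q : List (A × A)) → flat (P ++ Q) ≡ flat P ++ flat Q
flat-++ [] Q = refl
flat-++ ((x , y) ∷ P) Q = cong (λ l → x ∷ y ∷ l) (flat-++ P Q)

∈-flatˡ : {A : Set} {x y : A} (P : List (A × A)) → (x , y) ∈ˡ P → x ∈ˡ flat P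
∈-flatˡ (_ ∷ P) (here refl) = here refl
∈-flatˡ (_ ∷ P) (there p) = there (there (∈-flatˡ P p))

∈-flatʳ : {A : Set} {x y : A} (P : List (A × A)) → (x , y) ∈ˡ P → y ∈ˡ flat P
∈-flatʳ (_ ∷ P) (here refl) = there (here refl)
∈-flatʳ (_ ∷ P) (there p) = there (there (∈-flatʳ P p))

∈-flat⁻ : {A : Set} {x : A} (P : List (A × A)) → x ∈ˡ flat P → ∃ λ y → (x , y) ∈ˡ P ⊎ (y , x) ∈ˡ P
∈-flat⁻ ((x , y) ∷ P) (here refl) = y , inj₁ (here refl)
∈-flat⁻ ((x , y) ∷ P) (there (here refl)) = x , inj₂ (here refl)
∈-flat⁻ (_ ∷ P) (there (there p)) with ∈-flat⁻ P p
... | y , inj₁ q = y , inj₁ (there q)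
... | y , inj₂ q = y , inj₂ (there q)

module _ {A : Set} where

  Unique-++ˡ : (xs : List A) {ys : List A} → Unique (xs ++ ys) → Unique xs
  Unique-++ˡ [] u = []
  Unique-++ˡ (x ∷ xs) (h ∷ u) = ++⁻ˡ xs h ∷ Unique-++ˡ xs u

  AllPairs-lookup : {R : A → A → Set} {xs : List A} → AllPairs R xs →
                    ∀ {x y} → x ∈ˡ xs → y ∈ˡ xs → x ≢ y → R x y ⊎ R y x
  AllPairs-lookup (h ∷ ps) (here refl) (here refl) ne = ⊥-elim (ne refl)
  AllPairs-lookup (h ∷ ps) (here refl) (there q) ne = inj₁ (All.lookup h q)
  AllPairs-lookup (h ∷ ps) (there p) (here refl) ne = inj₂ (All.lookup h p)
  AllPairs-lookup (h ∷ ps) (there p) (there q) ne = AllPairs-lookup ps p q ne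

  module _ (R : A → A → Set) where

    -- A maximal matching in the graph of `R`; `unrelated` expresses maximality. The permutation
    -- transports both distinctness and sums between `xs` and the two parts.
    record Greedy (xs : List A) : Set where
      constructor greedy
      field
        pairs    : List (A × A)
        left     : List A
        perm     : flat pairs ++ left ↭ xs
        related  : All (λ p → R (proj₁ p) (proj₂ p)) pairs
        unrelated : AllPairs (λ x y → ¬ R x y) left

  module _ {R : A → A → Set} (R? : Decidable₂ R) where

    extract : ∀ x (ys : List A) → AllPairs (λ x y → ¬ R x y) ys →
              All (λ y → ¬ R x y) ys
              ⊎ (∃ λ y → ∃ λ zs → R x y × (y ∷ zs ↭ ys) × AllPairs (λ x y → ¬ R x y) zs ×
                  (∀ {Q : A → Set} → All Q ys → All Q zs))
    extract x [] ap = inj₁ []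
    extract x (y ∷ ys) (h ∷ ap) with R? x y
    ... | yes r = inj₂ (y , ys , r , refl , ap , λ { (_ ∷ qs) → qs })
    ... | no ¬r with extract x ys ap
    ... | inj₁ a = inj₁ (¬r ∷ a)
    ... | inj₂ (z , zs , r , p , ap′ , sub) =
          inj₂ (z , y ∷ zs , r , ↭-trans (swap z y refl) (prep y p) , sub h ∷ ap′ ,
                λ { (q ∷ qs) → q ∷ sub qs })

    pairUp : ∀ xs → Greedy R xs
    pairUp [] = greedy [] [] refl [] []
    pairUp (x ∷ xs) with pairUp xs
    ... | greedy P Lo perm rel unrel with extract x Lo unrel
    ... | inj₁ a = greedy P (x ∷ Lo) (↭-trans (shift x (flat P) Lo) (prep x perm)) rel (a ∷ unrel)
    ... | inj₂ (y , zs , r , p , ap , _) =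
          greedy ((x , y) ∷ P) zs
                 (prep x (↭-trans (↭-sym (shift y (flat P) zs)) (↭-trans (++⁺ˡ (flat P) p) perm)))
                 (r ∷ rel) ap

Bichromatic : {A : Set} → (A → Bool) → List (A × A) → Set
Bichromatic ψ = All (λ p → ψ (proj₁ p) ≢ ψ (proj₂ p))

record Matching {m : ℕ} (N : Fin m → Fin m → Set) : Set where
  field
    dec?  : Decidable₂ N
    symm  : ∀ {x y} → N x y → N y x
    irref : ∀ {x} → ¬ N x x
    func  : ∀ {x y z} → N x y → N x z → y ≡ z

module _ {m : ℕ} where

  private A = Fin m

  module Contract {N : A → A → Set} (M : Matching N) (x y : A) (x≢y : x ≢ y) where
    open Matching M

    -- An edge of `N` at `x`, the pair `(x , y)` and an edge of `N` at `y` form a path of three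
    -- edges. Every proper two-colouring gives its ends different colours, so a single edge between
    -- these ends records the same constraint.
    N′ : A → A → Set
    N′ e f = ((e ≢ x × e ≢ y) × (f ≢ x × f ≢ y)) × (N e f ⊎ ((N x e × N y f) ⊎ (N y e × N x f)))

    contracted : Matching N′
    contracted = record
      { dec? = λ e f → ((¬? (e ≟ᶠ x) ×-dec ¬? (e ≟ᶠ y)) ×-dec (¬? (f ≟ᶠ x) ×-dec ¬? (f ≟ᶠ y))) ×-dec
                       (dec? e f ⊎-dec ((dec? x e ×-dec dec? y f) ⊎-dec (dec? y e ×-dec dec? x f)))
      ; symm = λ { ((p , q) , inj₁ n) → (q , p) , inj₁ (symm n)
                 ; ((p , q) , inj₂ (inj₁ (a , b))) → (q , p) , inj₂ (inj₂ (b , a))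
                 ; ((p , q) , inj₂ (inj₂ (a , b))) → (q , p) , inj₂ (inj₁ (b , a)) }
      ; irref = λ { (_ , inj₁ n) → irref n
                  ; (_ , inj₂ (inj₁ (a , b))) → x≢y (func (symm a) (symm b))
                  ; (_ , inj₂ (inj₂ (a , b))) → x≢y (func (symm b) (symm a)) }
      ; func = fn
      }
      where
      fn : ∀ {e f g} → N′ e f → N′ e g → f ≡ g
      fn (_ , inj₁ n) (_ , inj₁ n′) = func n n′
      fn ((_ , (fx , _)) , inj₁ n) (_ , inj₂ (inj₁ (a , _))) = ⊥-elim (fx (func n (symm a)))
      fn ((_ , (_ , fy)) , inj₁ n) (_ , inj₂ (inj₂ (a , _))) = ⊥-elim (fy (func n (symm a)))
      fn (_ , inj₂ (inj₁ (a , _))) ((_ , (gx , _)) , inj₁ n) = ⊥-elim (gx (func n (symm a)))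
      fn (_ , inj₂ (inj₁ (_ , b))) (_ , inj₂ (inj₁ (_ , b′))) = func b b′
      fn (_ , inj₂ (inj₁ (a , _))) (_ , inj₂ (inj₂ (a′ , _))) = ⊥-elim (x≢y (func (symm a) (symm a′)))
      fn (_ , inj₂ (inj₂ (a , _))) ((_ , (_ , gy)) , inj₁ n) = ⊥-elim (gy (func n (symm a)))
      fn (_ , inj₂ (inj₂ (a , _))) (_ , inj₂ (inj₁ (a′ , _))) = ⊥-elim (x≢y (func (symm a′) (symm a)))
      fn (_ , inj₂ (inj₂ (_ , b))) (_ , inj₂ (inj₂ (_ , b′))) = func b b′

    module Extend (ψ : A → Bool) (proper : ∀ {e f} → N′ e f → ψ e ≢ ψ f) where

      -- `c` is meant for `x` and `not c` for `y`. If both have outside partners `z` and `w`, these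
      -- are joined in `N′`, so `ψ z` and `ψ w` differ, and avoiding the former at `x` avoids the
      -- latter at `y`. The exclusions `z ≢ y` and `w ≢ x` allow for `N` matching `x` with `y`
      -- itself.
      choose : ∃ λ c → (∀ z → z ≢ y → N x z → c ≢ ψ z) × (∀ w → w ≢ x → N y w → not c ≢ ψ w)
      choose with any? (λ z → ¬? (z ≟ᶠ y) ×-dec dec? x z) | any? (λ w → ¬? (w ≟ᶠ x) ×-dec dec? y w)
      ... | no ¬z | no ¬w = true , (λ z p q → ⊥-elim (¬z (z , p , q))) , λ w p q → ⊥-elim (¬w (w , p , q))
      ... | no ¬z | yes (w , _ , yw) =
            ψ w , (λ z p q → ⊥-elim (¬z (z , p , q))) ,
            λ w′ _ yw′ e → not-¬ (cong ψ (func yw′ yw)) (sym e)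
      ... | yes (z , z≢y , xz) | yes (w , w≢x , yw) =
            not (ψ z) , (λ z′ _ xz′ e → not-¬ (cong ψ (func xz′ xz)) (sym e)) ,
            λ w′ _ yw′ e → proper {z} {w}
              ((((λ { refl → irref xz }) , z≢y) , (w≢x , λ { refl → irref yw })) , inj₂ (inj₁ (xz , yw)))
              (trans (sym (not-involutive (ψ z))) (trans e (cong ψ (func yw′ yw))))
      ... | yes (z , _ , xz) | no ¬w =
            not (ψ z) , (λ z′ _ xz′ e → not-¬ (cong ψ (func xz′ xz)) (sym e)) ,
            λ w p q → ⊥-elim (¬w (w , p , q))

      ψ′ : A → Bool
      ψ′ e with e ≟ᶠ x | e ≟ᶠ y
      ... | yes _ | _ = proj₁ choose
      ... | no _ | yes _ = not (proj₁ choose)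
      ... | no _ | no _ = ψ e

      ψ′-x : ψ′ x ≡ proj₁ choose
      ψ′-x with x ≟ᶠ x
      ... | yes _ = refl
      ... | no ne = ⊥-elim (ne refl)

      ψ′-y : ψ′ y ≡ not (proj₁ choose)
      ψ′-y with y ≟ᶠ x | y ≟ᶠ y
      ... | yes e | _ = ⊥-elim (x≢y (sym e))
      ... | no _ | yes _ = refl
      ... | no _ | no ne = ⊥-elim (ne refl)

      ψ′-other : ∀ {e} → e ≢ x → e ≢ y → ψ′ e ≡ ψ e
      ψ′-other {e} ex ey with e ≟ᶠ x | e ≟ᶠ y
      ... | yes p | _ = ⊥-elim (ex p)
      ... | no _ | yes p = ⊥-elim (ey p)
      ... | no _ | no _ = refl

      ψ′-xy : ψ′ x ≢ ψ′ y
      ψ′-xy e = not-¬ {proj₁ choose} refl (trans (sym ψ′-x) (trans e ψ′-y))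

      ψ′-xN : ∀ {f} → N x f → ψ′ x ≢ ψ′ f
      ψ′-xN {f} n = split (f ≟ᶠ y)
        where
        split : Dec (f ≡ y) → ψ′ x ≢ ψ′ f
        split (yes refl) = ψ′-xy
        split (no f≢y) e = proj₁ (proj₂ choose) f f≢y n
                             (trans (sym ψ′-x) (trans e (ψ′-other (λ { refl → irref n }) f≢y)))

      ψ′-yN : ∀ {f} → N y f → ψ′ y ≢ ψ′ f
      ψ′-yN {f} n = split (f ≟ᶠ x)
        where
        split : Dec (f ≡ x) → ψ′ y ≢ ψ′ f
        split (yes refl) = ψ′-xy ∘ sym
        split (no f≢x) e = proj₂ (proj₂ choose) f f≢x n
                             (trans (sym ψ′-y) (trans e (ψ′-other f≢x (λ { refl → irref n }))))

      ψ′-proper : ∀ {e f} → N e f → ψ′ e ≢ ψ′ f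
      ψ′-proper {e} {f} n = split (e ≟ᶠ x) (e ≟ᶠ y) (f ≟ᶠ x) (f ≟ᶠ y)
        where
        split : Dec (e ≡ x) → Dec (e ≡ y) → Dec (f ≡ x) → Dec (f ≡ y) → ψ′ e ≢ ψ′ f
        split (yes refl) _ _ _ = ψ′-xN n
        split (no _) (yes refl) _ _ = ψ′-yN n
        split (no _) (no _) (yes refl) _ = ψ′-xN (symm n) ∘ sym
        split (no _) (no _) (no _) (yes refl) = ψ′-yN (symm n) ∘ sym
        split (no a) (no b) (no c) (no d) q =
          proper (((a , b) , (c , d)) , inj₁ n) (trans (sym (ψ′-other a b)) (trans q (ψ′-other c d)))

  -- In each edge the end with the smaller index is coloured `true`.
  matching-bichromatic : {N : A → A → Set} → Matching N → ∃ λ (ψ : A → Bool) → ∀ {e f} → N e f → ψ e ≢ ψ f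
  matching-bichromatic {N} M = ψ , proper
    where
    open Matching M
    up? : Decidable (λ e → ∃ λ f → N e f × e <ᶠ f)
    up? e = any? (λ f → dec? e f ×-dec e <ᶠ? f)
    ψ : A → Bool
    ψ e = does (up? e)
    clash : {B C : Set} (p : Dec B) (q : Dec C) → B → ¬ C → does p ≢ does q
    clash (yes _) (yes c) b ¬c _ = ¬c c
    clash (no ¬b) q b ¬c _ = ¬b b
    proper : ∀ {e f} → N e f → ψ e ≢ ψ f
    proper {e} {f} n eq with <ᶠ-cmp e f
    ... | tri≈ _ refl _ = irref n
    ... | tri< e<f _ _ = clash (up? e) (up? f) (f , n , e<f)
            (λ { (g , n′ , f<g) → <ᶠ-asym e<f (subst (f <ᶠ_) (func n′ (symm n)) f<g) }) eq
    ... | tri> _ _ f<e = clash (up? f) (up? e) (e , symm n , f<e)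
            (λ { (g , n′ , e<g) → <ᶠ-asym f<e (subst (e <ᶠ_) (func n′ n) e<g) }) (sym eq)

  -- Contracting a pair (x , y) joins the partners of x and y in the other matching.
  twoColouring : ∀ L → Unique (flat L) → {N : A → A → Set} → Matching N →
                 ∃ λ (ψ : A → Bool) → Bichromatic ψ L × (∀ {e f} → N e f → ψ e ≢ ψ f)
  twoColouring [] u M with matching-bichromatic M
  ... | ψ , p = ψ , [] , p
  twoColouring ((x , y) ∷ L) ((x≢y ∷ x∉) ∷ (y∉ ∷ u)) M
    with twoColouring L u (Contract.contracted M x y x≢y)
  ... | ψ , bi , proper = ψ′ , ψ′-xy ∷ All.tabulate stay , ψ′-proper
    where
    open Contract M x y x≢y using (module Extend)
    open Extend ψ proper
    off : ∀ {e} → e ∈ˡ flat L → ψ′ e ≡ ψ e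
    off e∈ = ψ′-other (λ { refl → All.lookup x∉ e∈ refl })
                                                  (λ { refl → All.lookup y∉ e∈ refl })
    stay : ∀ {p} → p ∈ˡ L → ψ′ (proj₁ p) ≢ ψ′ (proj₂ p)
    stay {e , f} p∈ q = All.lookup bi p∈
      (trans (sym (off (∈-flatˡ L p∈))) (trans q (off (∈-flatʳ L p∈))))

  Linked : List (A × A) → A → A → Set
  Linked P e f = (e , f) ∈ˡ P ⊎ (f , e) ∈ˡ P

  linked-matching : ∀ P → Unique (flat P) → Matching (Linked P)
  linked-matching P u = record
    { dec? = λ e f → mem? (≡-dec× _≟ᶠ_ _≟ᶠ_) (e , f) P ⊎-dec mem? (≡-dec× _≟ᶠ_ _≟ᶠ_) (f , e) P
    ; symm = λ { (inj₁ p) → inj₂ p ; (inj₂ p) → inj₁ p }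
    ; irref = λ { (inj₁ p) → irr P u p ; (inj₂ p) → irr P u p }
    ; func = fn P u
    }
    where
    irr : ∀ P → Unique (flat P) → ∀ {x} → ¬ ((x , x) ∈ˡ P)
    irr (_ ∷ P) ((ne ∷ _) ∷ _) (here refl) = ne refl
    irr (_ ∷ P) (_ ∷ (_ ∷ u)) (there p) = irr P u p
    linked-flat : ∀ P {x y} → Linked P x y → x ∈ˡ flat P
    linked-flat P (inj₁ p) = ∈-flatˡ P p
    linked-flat P (inj₂ p) = ∈-flatʳ P p
    tail : ∀ {q P x y} → Linked (q ∷ P) x y → ((x , y) ≡ q ⊎ (y , x) ≡ q) ⊎ Linked P x y
    tail (inj₁ (here e)) = inj₁ (inj₁ e)
    tail (inj₁ (there p)) = inj₂ (inj₁ p)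
    tail (inj₂ (here e)) = inj₁ (inj₂ e)
    tail (inj₂ (there p)) = inj₂ (inj₂ p)
    fn : ∀ P → Unique (flat P) → ∀ {x y z} → Linked P x y → Linked P x z → y ≡ z
    fn [] _ (inj₁ ())
    fn [] _ (inj₂ ())
    fn (q ∷ P) ((ne ∷ h₁) ∷ (h₂ ∷ u)) l l′ with tail l | tail l′
    ... | inj₁ (inj₁ refl) | inj₁ (inj₁ refl) = refl
    ... | inj₁ (inj₁ refl) | inj₁ (inj₂ refl) = refl
    ... | inj₁ (inj₂ refl) | inj₁ (inj₁ refl) = refl
    ... | inj₁ (inj₂ refl) | inj₁ (inj₂ refl) = refl
    ... | inj₁ (inj₁ refl) | inj₂ b = ⊥-elim (All.lookup h₁ (linked-flat P b) refl)
    ... | inj₁ (inj₂ refl) | inj₂ b = ⊥-elim (All.lookup h₂ (linked-flat P b) refl)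
    ... | inj₂ a | inj₁ (inj₁ refl) = ⊥-elim (All.lookup h₁ (linked-flat P a) refl)
    ... | inj₂ a | inj₁ (inj₂ refl) = ⊥-elim (All.lookup h₂ (linked-flat P a) refl)
    ... | inj₂ a | inj₂ b = fn P u a b

  -- The two matchings alternate along every cycle of their union, so all cycles are even. The list
  -- `P` drives the induction, while `Q` is contracted as a relation.
  twoMatchings : ∀ P Q → Unique (flat P) → Unique (flat Q) →
                 ∃ λ (ψ : A → Bool) → Bichromatic ψ P × Bichromatic ψ Q
  twoMatchings P Q u v with twoColouring P u (linked-matching Q v)
  ... | ψ , bp , bq = ψ , bp , All.tabulate (λ p∈ → bq (inj₁ p∈))

-- Kempe exchanges and the agreement of two colourings

module _ {m k : ℕ} where

  Colouring : Set
  Colouring = Fin m → Fin k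

  recolour : Fin k → Fin k → (Fin m → Bool) → Colouring → Colouring
  recolour i j ψ φ e =
    if does (φ e ≟ᶠ i) ∨ does (φ e ≟ᶠ j) then (if ψ e then i else j) else φ e

  -- The pairs depend on the colouring and the two colours but not on `ψ`, so one `ψ` can serve the
  -- pairs of two properties at once.
  Exchangeable : (Colouring → Set) → Set
  Exchangeable Φ = ∀ φ → Φ φ → ∀ i j → i ≢ j →
    ∃ λ (P : List (Fin m × Fin m)) → Unique (flat P) × (∀ ψ → Bichromatic ψ P → Φ (recolour i j ψ φ))

  recolour-on : ∀ {i j} ψ φ e → φ e ≡ i ⊎ φ e ≡ j → recolour i j ψ φ e ≡ (if ψ e then i else j)
  recolour-on {i} {j} ψ φ e h with φ e ≟ᶠ i | φ e ≟ᶠ j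
  ... | yes _ | _ = refl
  ... | no _ | yes _ = refl
  recolour-on ψ φ e (inj₁ p) | no a | no b = ⊥-elim (a p)
  recolour-on ψ φ e (inj₂ p) | no a | no b = ⊥-elim (b p)

  recolour-off : ∀ {i j} ψ φ e → φ e ≢ i → φ e ≢ j → recolour i j ψ φ e ≡ φ e
  recolour-off {i} {j} ψ φ e ni nj with φ e ≟ᶠ i | φ e ≟ᶠ j
  ... | yes p | _ = ⊥-elim (ni p)
  ... | no _ | yes p = ⊥-elim (nj p)
  ... | no _ | no _ = refl

  recolour-agree : ∀ {i j} ψ φ φ′ e → φ e ≡ φ′ e → recolour i j ψ φ e ≡ recolour i j ψ φ′ e
  recolour-agree {i} {j} ψ φ φ′ e eq rewrite eq = refl

  -- Recolouring by the same ψ keeps all agreements and creates one on an arc coloured i by φ and j by φ′.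
  common : {Φ Φ′ : Colouring → Set} → Exchangeable Φ → Exchangeable Φ′ →
           ∀ φ φ′ → Φ φ → Φ′ φ′ → ∃ λ χ → ∃ λ χ′ → Φ χ × Φ′ χ′ × (∀ e → χ e ≡ χ′ e)
  common {Φ} {Φ′} ex ex′ φ₀ φ₀′ = go φ₀ φ₀′ (<-wellFounded _)
    where
    differ : (φ φ′ : Colouring) → Decidable (λ e → φ e ≢ φ′ e)
    differ φ φ′ e = ¬? (φ e ≟ᶠ φ′ e)
    go : ∀ φ φ′ → Acc _<_ (# (differ φ φ′)) → Φ φ → Φ′ φ′ →
         ∃ λ χ → ∃ λ χ′ → Φ χ × Φ′ χ′ × (∀ e → χ e ≡ χ′ e)
    go φ φ′ (acc rs) p p′ with any? (differ φ φ′)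
    ... | no none = φ , φ′ , p , p′ , λ e → decidable-stable (φ e ≟ᶠ φ′ e) (λ ne → none (e , ne))
    ... | yes (e , ne) with ex φ p (φ e) (φ′ e) ne | ex′ φ′ p′ (φ e) (φ′ e) ne
    ... | P , u , f | P′ , u′ , f′ with twoMatchings P P′ u u′
    ... | ψ , bi , bi′ = go χ χ′ (rs (∑-mono-< down e strict)) (f ψ bi) (f′ ψ bi′)
      where
      i = φ e
      j = φ′ e
      χ = recolour i j ψ φ
      χ′ = recolour i j ψ φ′
      down : ∀ a → ⟦ differ χ χ′ a ⟧ ≤ ⟦ differ φ φ′ a ⟧
      down a = ⟦⟧-mono (differ χ χ′ a) (differ φ φ′ a)
                 (λ d eq → d (recolour-agree ψ φ φ′ a eq))
      strict : ⟦ differ χ χ′ e ⟧ < ⟦ differ φ φ′ e ⟧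
      strict = subst₂ _<_
        (sym (⟦⟧-no (differ χ χ′ e) (λ d → d (trans (recolour-on ψ φ e (inj₁ refl))
                                                (sym (recolour-on ψ φ′ e (inj₂ refl)))))))
        (sym (⟦⟧-yes (differ φ φ′ e) ne)) (s≤s z≤n)

-- Extending a partial colouring to disjoint branchings

select : ∀ {n} {P : Fin n → Set} → Decidable P → Subset n
select P? = tabulate (does ∘ P?)

module _ {n} {P : Fin n → Set} (P? : Decidable P) where
  select⁺ : ∀ {v} → P v → v ∈ select P?
  select⁺ {v} p = lookup⇒[]= v _ (trans (lookup∘tabulate (does ∘ P?) v) (dec-true (P? v) p))

  select⁻ : ∀ {v} → v ∈ select P? → P v
  select⁻ {v} v∈ with P? v | trans (sym (lookup∘tabulate (does ∘ P?) v)) ([]=⇒lookup v∈)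
  ... | yes p | _ = p

-- A positive truncated difference falls by exactly one when `x` grows by one; the last hypothesis
-- rules out truncation when `δ` is 1.
∸-split : ∀ b x δ → δ ≤ 1 → (0 < δ → x < b) → b ∸ x ≡ (b ∸ (x + δ)) + δ
∸-split b x zero _ _ = trans (cong (b ∸_) (sym (+-identityʳ x))) (sym (+-identityʳ _))
∸-split (suc b) zero (suc zero) _ _ = +-comm 1 b
∸-split (suc b) (suc x) (suc zero) l h = ∸-split b x 1 l (λ z → s≤s⁻¹ (h z))
∸-split zero x (suc zero) l h with h (s≤s z≤n)
... | ()
∸-split b x (suc (suc δ)) (s≤s ()) h

#-witness : ∀ {n} {P : Fin n → Set} (P? : Decidable P) i → P i → 1 ≤ # P?
#-witness P? i p = ≤-trans (≤-reflexive (sym (⟦⟧-yes (P? i) p))) (∑-term≤ (λ i → ⟦ P? i ⟧) i)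

fibre? : ∀ {m k} {Q : Fin m → Set} → Decidable Q → (χ : Fin m → Fin k) → ∀ c → Decidable (λ a → Q a × χ a ≡ c)
fibre? Q? χ c a = Q? a ×-dec (χ a ≟ᶠ c)

-- Double counting: once the sums are interchanged, disjointness lets each `a` contribute at most
-- once.
∑-disjoint : ∀ {m k} {R : Fin k → Fin m → Set} {Q : Fin m → Set} (R? : ∀ c → Decidable (R c)) (Q? : Decidable Q) →
             (∀ {c a} → R c a → Q a) → (∀ {c d a} → R c a → R d a → c ≡ d) → sum (λ c → # (R? c)) ≤ # Q?
∑-disjoint {Q = Q} R? Q? R⇒Q disjoint = subst (_≤ # Q?) (∑-comm (λ a c → ⟦ R? c a ⟧)) (∑-mono each)
  where
  each : ∀ a → # (λ c → R? c a) ≤ ⟦ Q? a ⟧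
  each a = split (Q? a)
    where
    split : Dec (Q a) → # (λ c → R? c a) ≤ ⟦ Q? a ⟧
    split (yes q) = ≤-trans (#-one (λ c → R? c a) (λ _ _ → disjoint)) (≤-reflexive (sym (⟦⟧-yes (Q? a) q)))
    split (no ¬q) = ≤-trans (≤-reflexive (∑-zero _ (λ c → ⟦⟧-no (R? c a) (¬q ∘ R⇒Q)))) z≤n

∑-fibres : ∀ {m k} {Q : Fin m → Set} (Q? : Decidable Q) (χ : Fin m → Fin k) →
           sum (λ c → # (fibre? Q? χ c)) ≤ # Q?
∑-fibres Q? χ = ∑-disjoint (fibre? Q? χ) Q? proj₁ (λ p p′ → trans (sym (proj₂ p)) (proj₂ p′))

-- Numbers that differ by at most one cannot lie strictly on opposite sides of `b`, so no surplus of
-- one is lost to truncation while the other is short.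
∸-gather : ∀ b x y → x ≤ suc y → y ≤ suc x → (b ∸ x) + (b ∸ y) ≤ (b + b) ∸ (x + y)
∸-gather zero x y _ _ = ≤-trans (≤-reflexive (cong₂ _+_ (0∸n≡0 x) (0∸n≡0 y))) z≤n
∸-gather (suc b) zero zero _ _ = ≤-refl
∸-gather (suc b) zero (suc zero) _ _ = ≤-reflexive (sym (+-suc b b))
∸-gather (suc b) zero (suc (suc y)) _ (s≤s ())
∸-gather (suc b) (suc zero) zero _ _ = ≤-refl
∸-gather (suc b) (suc (suc x)) zero (s≤s ()) _
∸-gather (suc b) (suc x) (suc y) (s≤s p) (s≤s q) =
  subst₂ (λ s t → (b ∸ x) + (b ∸ y) ≤ s ∸ t) (sym (+-suc b b)) (sym (+-suc x y)) (∸-gather b x y p q)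

-- Convexity of the truncated difference: among all splittings of a fixed total, a balanced one has
-- the least total deficit. The deficit of the total bounds every splitting from below, and a
-- balanced one attains it.
∸-balanced : ∀ b x y x′ y′ → x ≤ suc y → y ≤ suc x → x + y ≡ x′ + y′ →
             (b ∸ x) + (b ∸ y) ≤ (b ∸ x′) + (b ∸ y′)
∸-balanced b x y x′ y′ p q eq = begin
  (b ∸ x) + (b ∸ y)     ≤⟨ ∸-gather b x y p q ⟩
  (b + b) ∸ (x + y)     ≡⟨ cong ((b + b) ∸_) eq ⟩
  (b + b) ∸ (x′ + y′)   ≤⟨ m≤n+o⇒m∸n≤o (b + b) (x′ + y′) (begin
    b + b                                     ≤⟨ +-mono-≤ (m≤n+m∸n b x′) (m≤n+m∸n b y′) ⟩
    (x′ + (b ∸ x′)) + (y′ + (b ∸ y′))         ≡⟨ solve 4 (λ s t u v → (s :+ t) :+ (u :+ v) := (s :+ u) :+ (t :+ v)) refl x′ _ y′ _ ⟩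
    (x′ + y′) + ((b ∸ x′) + (b ∸ y′))         ∎) ⟩
  (b ∸ x′) + (b ∸ y′)   ∎
  where
  open ≤-Reasoning
  open +-*-Solver

∑ᴸ : {A : Set} → (A → ℕ) → List A → ℕ
∑ᴸ f [] = 0
∑ᴸ f (x ∷ xs) = f x + ∑ᴸ f xs

∑ᴸ-++ : {A : Set} (f : A → ℕ) (xs ys : List A) → ∑ᴸ f (xs ++ ys) ≡ ∑ᴸ f xs + ∑ᴸ f ys
∑ᴸ-++ f [] ys = refl
∑ᴸ-++ f (x ∷ xs) ys = trans (cong (f x +_) (∑ᴸ-++ f xs ys)) (sym (+-assoc (f x) _ _))

∑ᴸ-↭ : {A : Set} (f : A → ℕ) {xs ys : List A} → xs ↭ ys → ∑ᴸ f xs ≡ ∑ᴸ f ys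
∑ᴸ-↭ f refl = refl
∑ᴸ-↭ f (prep x p) = cong (f x +_) (∑ᴸ-↭ f p)
∑ᴸ-↭ f (↭-trans p q) = trans (∑ᴸ-↭ f p) (∑ᴸ-↭ f q)
∑ᴸ-↭ f {x ∷ y ∷ xs} {_ ∷ _ ∷ ys} (swap x y p) = begin
  f x + (f y + ∑ᴸ f xs) ≡⟨ cong (λ z → f x + (f y + z)) (∑ᴸ-↭ f p) ⟩
  f x + (f y + ∑ᴸ f ys) ≡⟨ sym (+-assoc (f x) (f y) _) ⟩
  f x + f y + ∑ᴸ f ys   ≡⟨ cong (_+ ∑ᴸ f ys) (+-comm (f x) (f y)) ⟩
  f y + f x + ∑ᴸ f ys   ≡⟨ +-assoc (f y) (f x) _ ⟩
  f y + (f x + ∑ᴸ f ys) ∎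
  where open ≡-Reasoning

∑ᴸ-tabulate : ∀ {n} {A : Set} (f : A → ℕ) (g : Fin n → A) → ∑ᴸ f (tabulateˡ g) ≡ sum (f ∘ g)
∑ᴸ-tabulate {zero} f g = refl
∑ᴸ-tabulate {suc n} f g = cong (f (g zero) +_) (∑ᴸ-tabulate f (g ∘ suc))

∑ᴸ-flat : {A : Set} (f g : A → ℕ) (P : List (A × A)) →
          All (λ p → f (proj₁ p) + f (proj₂ p) ≡ g (proj₁ p) + g (proj₂ p)) P → ∑ᴸ f (flat P) ≡ ∑ᴸ g (flat P)
∑ᴸ-flat f g [] [] = refl
∑ᴸ-flat f g ((x , y) ∷ P) (e ∷ es) = begin
  f x + (f y + ∑ᴸ f (flat P)) ≡⟨ sym (+-assoc (f x) (f y) _) ⟩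
  f x + f y + ∑ᴸ f (flat P)   ≡⟨ cong₂ _+_ e (∑ᴸ-flat f g P es) ⟩
  g x + g y + ∑ᴸ g (flat P)   ≡⟨ +-assoc (g x) (g y) _ ⟩
  g x + (g y + ∑ᴸ g (flat P)) ∎
  where open ≡-Reasoning

-- Two members satisfying `P` would be related, against the maximality of the greedy pairing that
-- left them over.
∑ᴸ-≤1 : {A : Set} {P : A → Set} {R : A → A → Set} (P? : Decidable P) →
        (∀ {x y} → P x → P y → R x y) → ∀ {xs} → AllPairs (λ x y → ¬ R x y) xs → ∑ᴸ (λ x → ⟦ P? x ⟧) xs ≤ 1
∑ᴸ-≤1 P? r [] = z≤n
∑ᴸ-≤1 {P = P} {R} P? r (_∷_ {x = x} {xs = xs} h ap) with P? x
... | no _ = ∑ᴸ-≤1 P? r ap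
... | yes p = ≤-reflexive (cong suc (none h))
  where
  none : ∀ {ys} → All (λ y → ¬ R x y) ys → ∑ᴸ (λ x → ⟦ P? x ⟧) ys ≡ 0
  none [] = refl
  none {y ∷ _} (¬r ∷ h) = cong₂ _+_ (⟦⟧-no (P? y) (¬r ∘ r p)) (none h)

Unique-resp-↭ : {A : Set} {xs ys : List A} → xs ↭ ys → Unique xs → Unique ys
Unique-resp-↭ {A} p = SetoidPerm.Unique-resp-↭ (setoid A) (↭⇒↭ₛ p)

-- Partial colourings on one side of the partition

module Side {n m : ℕ} (tl hd : Fin m → Fin n) (loopless : ∀ a → tl a ≢ hd a)
            (T : Subset n) (o : Fin n) (o∉T : o ∉ T)
            (b : Fin n → ℕ) (bpos : ∀ v → b v > 0) (k : ℕ) where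

  State : Set
  State = Fin m → Maybe (Fin k)

  _≟ᵐ_ : (x y : Maybe (Fin k)) → Dec (x ≡ y)
  _≟ᵐ_ = ≡-decᵐ _≟ᶠ_

  Enters : Subset n → Fin m → Set
  Enters U a = hd a ∈ U × tl a ∉ U

  enters? : ∀ U → Decidable (Enters U)
  enters? U a = (hd a ∈? U) ×-dec ¬? (tl a ∈? U)

  enters-⁅hd⁆ : ∀ {a v} → hd a ≡ v → Enters ⁅ v ⁆ a
  enters-⁅hd⁆ {a} refl = x∈⁅x⁆ _ , loopless a ∘ x∈⁅y⁆⇒x≡y _

  enters-⁅⁆⇒hd : ∀ {a v} → Enters ⁅ v ⁆ a → hd a ≡ v
  enters-⁅⁆⇒hd = x∈⁅y⁆⇒x≡y _ ∘ proj₁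

  free? : ∀ (σ : State) U → Decidable (λ a → σ a ≡ nothing × Enters U a)
  free? σ U a = (σ a ≟ᵐ nothing) ×-dec enters? U a

  free : State → Subset n → ℕ
  free σ U = # (free? σ U)

  -- Every vertex outside T serves as a root for every colour.
  In : State → Fin k → Fin n → Set
  In σ c v = v ∉ T ⊎ ∃ λ a → σ a ≡ just c × hd a ≡ v

  in? : ∀ σ c → Decidable (In σ c)
  in? σ c v = ¬? (v ∈? T) ⊎-dec any? (λ a → (σ a ≟ᵐ just c) ×-dec (hd a ≟ᶠ v))

  -- A colour that does not touch a nonempty `U` must still be given to a free arc entering `U`;
  -- `missing` counts these demands and `free` the supply.
  Touch : State → Subset n → Fin k → Set
  Touch σ U c = ∃ λ v → v ∈ U × In σ c v

  touch? : ∀ σ U → Decidable (Touch σ U)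
  touch? σ U c = any? (λ v → (v ∈? U) ×-dec in? σ c v)

  miss : State → Subset n → Fin k → ℕ
  miss σ U c = ⟦ ¬? (touch? σ U c) ⟧

  missing : State → Subset n → ℕ
  missing σ U = sum (miss σ U)

  indeg? : ∀ (σ : State) c v → Decidable (λ a → σ a ≡ just c × Enters ⁅ v ⁆ a)
  indeg? σ c v a = (σ a ≟ᵐ just c) ×-dec enters? ⁅ v ⁆ a

  indeg : State → Fin k → Fin n → ℕ
  indeg σ c v = # (indeg? σ c v)

  -- Truncation keeps a surplus in one colour from paying for a shortage in another.
  deficit : State → Fin n → ℕ
  deficit σ v = sum (λ c → b v ∸ indeg σ c v)

  -- Edmonds' condition. Sets that leave `T` satisfy it trivially, since they contain a root of
  -- every colour; admitting them keeps the family closed under unions.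
  Cut : State → Set
  Cut σ = ∀ U → Nonempty U → missing σ U ≤ free σ U

  Deg : State → Set
  Deg σ = ∀ v → v ∈ T → deficit σ v ≤ free σ ⁅ v ⁆

  data Reached (σ : State) (c : Fin k) : Fin n → Set where
    root : ∀ {v} → v ∉ T → Reached σ c v
    arc  : ∀ a → σ a ≡ just c → Reached σ c (tl a) → Reached σ c (hd a)

  _⊑_ : State → State → Set
  σ ⊑ τ = ∀ {a c} → σ a ≡ just c → τ a ≡ just c

  In-mono : ∀ {σ τ c v} → σ ⊑ τ → In σ c v → In τ c v
  In-mono le (inj₁ x) = inj₁ x
  In-mono le (inj₂ (a , e , h)) = inj₂ (a , le e , h)

  Touch-mono : ∀ {σ τ U c} → σ ⊑ τ → Touch σ U c → Touch τ U c
  Touch-mono le (v , v∈ , i) = v , v∈ , In-mono le i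

  Reached-mono : ∀ {σ τ c v} → σ ⊑ τ → Reached σ c v → Reached τ c v
  Reached-mono le (root x) = root x
  Reached-mono le (arc a e r) = arc a (le e) (Reached-mono le r)

  -- Arc by arc: an arc entering the intersection or the union enters `U` or `W`, and one entering
  -- both enters both.
  free-submodular : ∀ σ U W → free σ (U ∩ W) + free σ (U ∪ W) ≤ free σ U + free σ W
  free-submodular σ U W = ∑-mono₂ λ a →
    ⟦⟧-cross (free? σ (U ∩ W) a) (free? σ (U ∪ W) a) (free? σ U a) (free? σ W a)
      (λ { (f , h , t) → meet a f (x∈p∩q⁻ U W h) t })
      (λ { (f , h , t) → join f t (x∈p∪q⁻ U W h) })
      (λ { (f , h , _) (_ , _ , t) →
           (f , proj₁ (x∈p∩q⁻ U W h) , t ∘ x∈p∪q⁺ ∘ inj₁) ,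
           (f , proj₂ (x∈p∩q⁻ U W h) , t ∘ x∈p∪q⁺ ∘ inj₂) })
    where
    meet : ∀ a → σ a ≡ nothing → hd a ∈ U × hd a ∈ W → tl a ∉ U ∩ W →
           (σ a ≡ nothing × Enters U a) ⊎ (σ a ≡ nothing × Enters W a)
    meet a f (hU , hW) t with tl a ∈? U
    ... | no t∉U = inj₁ (f , hU , t∉U)
    ... | yes t∈U = inj₂ (f , hW , λ t∈W → t (x∈p∩q⁺ (t∈U , t∈W)))
    join : ∀ {a} → σ a ≡ nothing → tl a ∉ U ∪ W → hd a ∈ U ⊎ hd a ∈ W →
           (σ a ≡ nothing × Enters U a) ⊎ (σ a ≡ nothing × Enters W a)
    join f t (inj₁ h) = inj₁ (f , h , t ∘ x∈p∪q⁺ ∘ inj₁)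
    join f t (inj₂ h) = inj₂ (f , h , t ∘ x∈p∪q⁺ ∘ inj₂)

  -- A colour that misses `U` or `W` misses the intersection, and one that misses both also misses
  -- the union.
  miss-supermodular : ∀ σ U W c → miss σ U c + miss σ W c ≤ miss σ (U ∩ W) c + miss σ (U ∪ W) c
  miss-supermodular σ U W c =
    ⟦⟧-cross (¬? (touch? σ U c)) (¬? (touch? σ W c)) (¬? (touch? σ (U ∩ W) c)) (¬? (touch? σ (U ∪ W) c))
      (λ ¬U → inj₁ (¬U ∘ shrinkU))
      (λ ¬W → inj₁ (¬W ∘ shrinkW))
      (λ ¬U ¬W → ¬U ∘ shrinkU , λ { (v , v∈ , i) →
         [ (λ v∈U → ¬U (v , v∈U , i)) , (λ v∈W → ¬W (v , v∈W , i)) ]′ (x∈p∪q⁻ U W v∈) })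
    where
    shrinkU : Touch σ (U ∩ W) c → Touch σ U c
    shrinkU (v , v∈ , i) = v , proj₁ (x∈p∩q⁻ U W v∈) , i
    shrinkW : Touch σ (U ∩ W) c → Touch σ W c
    shrinkW (v , v∈ , i) = v , proj₂ (x∈p∩q⁻ U W v∈) , i

  abstract
    set : State → Fin m → Fin k → State
    set σ a c e = if does (e ≟ᶠ a) then just c else σ e

    set-at : ∀ {σ a c} → set σ a c a ≡ just c
    set-at {σ} {a} with a ≟ᶠ a
    ... | yes _ = refl
    ... | no ne = ⊥-elim (ne refl)

    set-off : ∀ {σ a c e} → e ≢ a → set σ a c e ≡ σ e
    set-off {σ} {a} {c} {e} ne with e ≟ᶠ a
    ... | yes p = ⊥-elim (ne p)
    ... | no _ = refl

  module _ {σ : State} {a : Fin m} {c : Fin k} where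

    set-inv : ∀ {e c′} → set σ a c e ≡ just c′ → (e ≡ a × c′ ≡ c) ⊎ σ e ≡ just c′
    set-inv {e} eq with e ≟ᶠ a
    ... | yes refl = inj₁ (refl , just-injective (trans (sym eq) set-at))
    ... | no ne = inj₂ (trans (sym (set-off ne)) eq)

    module _ (fresh : σ a ≡ nothing) where

      set-⊑ : σ ⊑ set σ a c
      set-⊑ {e} eq with e ≟ᶠ a
      ... | no ne = trans (set-off ne) eq
      ... | yes refl with trans (sym fresh) eq
      ... | ()

      free-set : ∀ U → free σ U ≡ free (set σ a c) U + ⟦ enters? U a ⟧
      free-set U = ∑-update a
        (λ e ne → ⟦⟧-cong (free? σ U e) (free? (set σ a c) U e)
          (λ { (f , x) → trans (set-off ne) f , x })
          (λ { (f , x) → trans (sym (set-off ne)) f , x }))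
        (trans (⟦⟧-cong (free? σ U a) (enters? U a) proj₂ (fresh ,_))
               (cong (_+ ⟦ enters? U a ⟧) (sym (⟦⟧-no (free? (set σ a c) U a) used))))
        where
        used : ∀ {U} → ¬ (set σ a c a ≡ nothing × Enters U a)
        used (f , _) with trans (sym set-at) f
        ... | ()

      uncoloured-set : # (λ e → σ e ≟ᵐ nothing) ≡ # (λ e → set σ a c e ≟ᵐ nothing) + 1
      uncoloured-set = ∑-update a
        (λ e ne → ⟦⟧-cong (σ e ≟ᵐ nothing) (set σ a c e ≟ᵐ nothing) (trans (set-off ne)) (trans (sym (set-off ne))))
        (trans (⟦⟧-yes (σ a ≟ᵐ nothing) fresh) (cong (_+ 1) (sym (⟦⟧-no (set σ a c a ≟ᵐ nothing) used))))
        where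
        used : set σ a c a ≢ nothing
        used f with trans (sym set-at) f
        ... | ()

      indeg-set-same : ∀ v → indeg (set σ a c) c v ≡ indeg σ c v + ⟦ enters? ⁅ v ⁆ a ⟧
      indeg-set-same v = ∑-update a
        (λ e ne → ⟦⟧-cong (indeg? (set σ a c) c v e) (indeg? σ c v e)
          (λ { (f , x) → trans (sym (set-off ne)) f , x })
          (λ { (f , x) → trans (set-off ne) f , x }))
        (trans (⟦⟧-cong (indeg? (set σ a c) c v a) (enters? ⁅ v ⁆ a) proj₂ (set-at ,_))
               (cong (_+ ⟦ enters? ⁅ v ⁆ a ⟧) (sym (⟦⟧-no (indeg? σ c v a) unused))))
        where
        unused : ¬ (σ a ≡ just c × Enters ⁅ v ⁆ a)
        unused (f , _) with trans (sym fresh) f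
        ... | ()

      indeg-set-other : ∀ {c′} v → c′ ≢ c → indeg (set σ a c) c′ v ≡ indeg σ c′ v
      indeg-set-other {c′} v ne = sum-cong-≗ λ e →
        ⟦⟧-cong (indeg? (set σ a c) c′ v e) (indeg? σ c′ v e)
          (λ { (f , x) → [ (λ { (_ , eq) → ⊥-elim (ne eq) }) , _, x ]′ (set-inv f) })
          (λ { (f , x) → set-⊑ f , x })

      -- At its head the arc removes one unit of supply and, since `c` is short there, exactly one
      -- unit of deficit. At other vertices both amounts are unchanged.
      Deg-set : indeg σ c (hd a) < b (hd a) → Deg σ → Deg (set σ a c)
      Deg-set short deg v v∈T = +-cancelʳ-≤ δ _ _ (begin
        deficit (set σ a c) v + δ      ≡⟨ sym (∑-update c other same) ⟩
        deficit σ v                    ≤⟨ deg v v∈T ⟩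
        free σ ⁅ v ⁆                   ≡⟨ free-set ⁅ v ⁆ ⟩
        free (set σ a c) ⁅ v ⁆ + δ     ∎)
        where
        open ≤-Reasoning
        δ = ⟦ enters? ⁅ v ⁆ a ⟧
        other : ∀ e → e ≢ c → b v ∸ indeg σ e v ≡ b v ∸ indeg (set σ a c) e v
        other e ne = cong (b v ∸_) (sym (indeg-set-other v ne))
        positive : (d : Dec (Enters ⁅ v ⁆ a)) → 0 < ⟦ d ⟧ → indeg σ c v < b v
        positive (yes x) _ = subst (λ w → indeg σ c w < b w) (enters-⁅⁆⇒hd x) short
        same : b v ∸ indeg σ c v ≡ (b v ∸ indeg (set σ a c) c v) + δ
        same = trans (∸-split (b v) (indeg σ c v) δ (⟦⟧≤1 (enters? ⁅ v ⁆ a)) (positive (enters? ⁅ v ⁆ a)))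
                     (cong (λ x → (b v ∸ x) + δ) (sym (indeg-set-same v)))

  -- The field `reach` turns the decidable local property `In`, having an incoming arc of the
  -- colour, into reachability from a root.
  record Extendable (σ : State) : Set where
    field
      reach : ∀ c v → In σ c v → Reached σ c v
      cut   : Cut σ
      deg   : Deg σ

  module _ (σ : State) (cut : Cut σ) (c : Fin k) where

    -- Giving colour `c` to a free arc entering such a set would use up supply without lowering the
    -- demand, because `c` touches the set already. These are the obstacles to colouring with `c`.
    Tight : Subset n → Set
    Tight U = free σ U ≤ missing σ U × Touch σ U c

    -- Uncrossing with the cut condition at the union. If `c` touched `U` and `W` but not their
    -- intersection, supermodularity would be strict at `c`, contradicting the cut condition at the
    -- intersection and the union.
    ∩-tight : ∀ {U W v} → v ∈ U ∩ W → Tight U → Tight W → Tight (U ∩ W)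
    ∩-tight {U} {W} {v} v∈ (tU , touchU) (tW , touchW) =
      +-cancelʳ-≤ (free σ (U ∪ W)) _ _ (begin
        free σ (U ∩ W) + free σ (U ∪ W)       ≤⟨ upper ⟩
        missing σ U + missing σ W             ≤⟨ ∑-mono₂ (miss-supermodular σ U W) ⟩
        missing σ (U ∩ W) + missing σ (U ∪ W) ≤⟨ +-monoʳ-≤ (missing σ (U ∩ W)) cut∪ ⟩
        missing σ (U ∩ W) + free σ (U ∪ W)    ∎)
      , decidable-stable (touch? σ (U ∩ W) c) (λ ¬t → <⇒≱ (gap ¬t) (begin
        missing σ (U ∩ W) + missing σ (U ∪ W) ≤⟨ +-mono-≤ (cut (U ∩ W) (v , v∈)) cut∪ ⟩
        free σ (U ∩ W) + free σ (U ∪ W)       ≤⟨ upper ⟩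
        missing σ U + missing σ W             ∎))
      where
      open ≤-Reasoning
      upper : free σ (U ∩ W) + free σ (U ∪ W) ≤ missing σ U + missing σ W
      upper = ≤-trans (free-submodular σ U W) (+-mono-≤ tU tW)
      cut∪ : missing σ (U ∪ W) ≤ free σ (U ∪ W)
      cut∪ = cut (U ∪ W) (v , x∈p∪q⁺ (inj₁ (proj₁ (x∈p∩q⁻ U W v∈))))
      gap : ¬ Touch σ (U ∩ W) c → missing σ U + missing σ W < missing σ (U ∩ W) + missing σ (U ∪ W)
      gap ¬t = ∑-mono₂-< (miss-supermodular σ U W) c
        (subst₂ _<_ (sym (cong₂ _+_ (⟦⟧-no (¬? (touch? σ U c)) (λ ¬t′ → ¬t′ touchU))
                                    (⟦⟧-no (¬? (touch? σ W c)) (λ ¬t′ → ¬t′ touchW))))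
                    (cong (_+ miss σ (U ∪ W) c) (sym (⟦⟧-yes (¬? (touch? σ (U ∩ W) c)) ¬t))) (s≤s z≤n))

    Crossing : Subset n → Fin m → Set
    Crossing W a = σ a ≡ nothing × (tl a ∈ W × In σ c (tl a)) × (hd a ∈ W × ¬ In σ c (hd a))

    -- Let `W′` consist of the vertices of `W` not yet in `c`. Every colour missing at `W` is
    -- missing at `W′`, and `c` is missing only at `W′`. So more free arcs enter `W′` than `W`, and
    -- a free arc entering `W′` but not `W` has its tail in `W` outside `W′`.
    crossing-arc : ∀ W → Tight W → (∃ λ x → x ∈ W × ¬ In σ c x) → ∃ (Crossing W)
    crossing-arc W (tight , touch) (x , x∈W , ¬in) = conclude
      (∑-<⇒∃ (λ a → ⟦ free? σ W a ⟧) (λ a → ⟦ free? σ W′ a ⟧)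
             (≤-<-trans tight (<-≤-trans more (cut W′ (x , select⁺ W′? (x∈W , ¬in))))))
      where
      W′? : Decidable (λ v → v ∈ W × ¬ In σ c v)
      W′? v = (v ∈? W) ×-dec ¬? (in? σ c v)
      W′ : Subset n
      W′ = select W′?
      more : missing σ W < missing σ W′
      more = ∑-mono-< (λ e → ⟦⟧-mono (¬? (touch? σ W e)) (¬? (touch? σ W′ e))
                        (λ { ¬t (v , v∈ , i) → ¬t (v , proj₁ (select⁻ W′? v∈) , i) })) c
             (subst₂ _<_ (sym (⟦⟧-no (¬? (touch? σ W c)) (λ ¬t → ¬t touch)))
                         (sym (⟦⟧-yes (¬? (touch? σ W′ c)) λ { (v , v∈ , i) → proj₂ (select⁻ W′? v∈) i }))
                         (s≤s z≤n))
      conclude : (∃ λ a → ⟦ free? σ W a ⟧ < ⟦ free? σ W′ a ⟧) → ∃ (Crossing W)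
      conclude (a , lt) with ⟦⟧-< (free? σ W a) (free? σ W′ a) lt
      ... | notW , fresh , h , t = a , fresh , (tl∈W , in-tl) , select⁻ W′? h
        where
        tl∈W : tl a ∈ W
        tl∈W = decidable-stable (tl a ∈? W) (λ t∉ → notW (fresh , proj₁ (select⁻ W′? h) , t∉))
        in-tl : In σ c (tl a)
        in-tl = decidable-stable (in? σ c (tl a)) (λ ni → t (select⁺ W′? (tl∈W , ni)))

    -- The cut inequality can fail only through the loss of the free arc `a`, so `a` enters `U` and
    -- there was no slack. Had `c` not touched `U`, the demand would have dropped together with the
    -- supply.
    blocking : ∀ {a} U → σ a ≡ nothing → Nonempty U → ¬ (missing (set σ a c) U ≤ free (set σ a c) U) →
               Enters U a × Tight U
    blocking {a} U fresh ne bad = entU , ≤-trans tight′ (∑-mono le) , touchU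
      where
      open ≤-Reasoning
      σ′ : State
      σ′ = set σ a c
      le : ∀ e → miss σ′ U e ≤ miss σ U e
      le e = ⟦⟧-mono (¬? (touch? σ′ U e)) (¬? (touch? σ U e)) (λ ¬t q → ¬t (Touch-mono (set-⊑ fresh) q))
      entU : Enters U a
      entU = decidable-stable (enters? U a) λ ¬e → bad (begin
        missing σ′ U                 ≤⟨ ∑-mono le ⟩
        missing σ U                  ≤⟨ cut U ne ⟩
        free σ U                     ≡⟨ free-set fresh U ⟩
        free σ′ U + ⟦ enters? U a ⟧  ≡⟨ cong (free σ′ U +_) (⟦⟧-no (enters? U a) ¬e) ⟩
        free σ′ U + 0                ≡⟨ +-identityʳ _ ⟩
        free σ′ U                    ∎)
      tight′ : free σ U ≤ missing σ′ U
      tight′ = begin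
        free σ U                     ≡⟨ free-set fresh U ⟩
        free σ′ U + ⟦ enters? U a ⟧  ≤⟨ +-monoʳ-≤ (free σ′ U) (⟦⟧≤1 (enters? U a)) ⟩
        free σ′ U + 1                ≡⟨ +-comm _ 1 ⟩
        suc (free σ′ U)              ≤⟨ ≰⇒> bad ⟩
        missing σ′ U                 ∎
      touchU : Touch σ U c
      touchU = decidable-stable (touch? σ U c) λ ¬t → <⇒≱ (∑-mono-< le c
        (subst₂ _<_ (sym (⟦⟧-no (¬? (touch? σ′ U c)) (λ ¬t′ → ¬t′ (hd a , proj₁ entU , inj₂ (a , set-at , refl)))))
                    (sym (⟦⟧-yes (¬? (touch? σ U c)) ¬t)) (s≤s z≤n)))
        (≤-trans (cut U ne) tight′)

    Safe : Fin m → Set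
    Safe a = σ a ≡ nothing × In σ c (tl a) × ¬ In σ c (hd a) × Cut (set σ a c)

    -- Lovász's argument: if the crossing arc of a tight set W cannot be given colour c, a tight set U
    -- blocks it, and the smaller tight set U ∩ W is crossed as well.
    safe-arc : ∀ W → Acc _<_ ∣ W ∣ → Tight W → (∃ λ x → x ∈ W × ¬ In σ c x) → ∃ Safe
    safe-arc W (acc rs) tight x = try (crossing-arc W tight x)
      where
      try : ∃ (Crossing W) → ∃ Safe
      try (a , fresh , (tl∈W , in-tl) , (hd∈W , ¬in-hd)) = decide (anySubset? violated?)
        where
        Violated : Subset n → Set
        Violated U = Nonempty U × ¬ (missing (set σ a c) U ≤ free (set σ a c) U)
        violated? : ∀ U → Dec (Violated U)
        violated? U = nonempty? U ×-dec ¬? (missing (set σ a c) U ≤? free (set σ a c) U)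
        decide : Dec (∃ Violated) → ∃ Safe
        decide (no none) = a , fresh , in-tl , ¬in-hd , λ U ne →
          decidable-stable (missing (set σ a c) U ≤? free (set σ a c) U) (λ q → none (U , ne , q))
        decide (yes (U , ne , bad)) = shrink (blocking U fresh ne bad)
          where
          shrink : Enters U a × Tight U → ∃ Safe
          shrink ((hd∈U , tl∉U) , tightU) =
            safe-arc (U ∩ W) (rs (p⊂q⇒∣p∣<∣q∣ smaller)) (∩-tight hd∈∩ tightU tight) (hd a , hd∈∩ , ¬in-hd)
            where
            hd∈∩ : hd a ∈ U ∩ W
            hd∈∩ = x∈p∩q⁺ (hd∈U , hd∈W)
            smaller : (U ∩ W) ⊂ W
            smaller = proj₂ ∘ x∈p∩q⁻ U W , tl a , tl∈W , λ t∈ → tl∉U (proj₁ (x∈p∩q⁻ U W t∈))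

  uncoloured : State → ℕ
  uncoloured σ = # (λ e → σ e ≟ᵐ nothing)

  uncoloured-set-< : ∀ {σ a c} → σ a ≡ nothing → uncoloured (set σ a c) < uncoloured σ
  uncoloured-set-< {σ} {a} {c} fresh =
    ≤-reflexive (sym (trans (uncoloured-set fresh) (+-comm _ 1)))

  -- The head had no incoming arc of colour `c`, so its indegree in `c` was 0, below the positive
  -- requirement; the tail is already reached, so the new arc reaches the head.
  Extendable-set : ∀ {σ c a} (ext : Extendable σ) → Safe σ (Extendable.cut ext) c a → Extendable (set σ a c)
  Extendable-set {σ} {c} {a} ext (fresh , in-tl , ¬in-hd , cut′) = record
    { reach = reach′ ; cut = cut′ ; deg = Deg-set fresh (subst (_< b (hd a)) (sym indeg≡0) (bpos (hd a))) deg }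
    where
    open Extendable ext
    up : σ ⊑ set σ a c
    up = set-⊑ fresh
    reach′ : ∀ c′ v → In (set σ a c) c′ v → Reached (set σ a c) c′ v
    reach′ c′ v (inj₁ v∉) = root v∉
    reach′ c′ v (inj₂ (e , eq , refl)) with set-inv eq
    ... | inj₁ (refl , refl) = arc a eq (Reached-mono up (reach c (tl a) in-tl))
    ... | inj₂ old = Reached-mono up (reach c′ (hd e) (inj₂ (e , old , refl)))
    indeg≡0 : indeg σ c (hd a) ≡ 0
    indeg≡0 = ∑-zero _ (λ e → ⟦⟧-no (indeg? σ c (hd a) e)
      (λ { (eq , en) → ¬in-hd (inj₂ (e , eq , enters-⁅⁆⇒hd en)) }))

  branchings : ∀ σ → Acc _<_ (uncoloured σ) → Extendable σ →
               ∃ λ τ → σ ⊑ τ × Deg τ × (∀ c v → Reached τ c v)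
  branchings σ (acc rs) ext = decide (any? (λ c → any? (λ v → ¬? (in? σ c v))))
    where
    open Extendable ext
    Goal : Set
    Goal = ∃ λ τ → σ ⊑ τ × Deg τ × (∀ c v → Reached τ c v)
    grow : ∀ {c} → ∃ (Safe σ cut c) → Goal
    grow {c} (a , safe@(fresh , _)) = weaken (branchings (set σ a c) (rs (uncoloured-set-< fresh)) (Extendable-set ext safe))
      where
      weaken : (∃ λ τ → set σ a c ⊑ τ × Deg τ × (∀ c v → Reached τ c v)) → Goal
      weaken (τ , le , r) = τ , (λ e → le (set-⊑ fresh e)) , r
    -- No arc enters the whole vertex set, and the root `o` makes every colour touch it, so it is
    -- tight and the search for a safe arc can start there.
    tight⊤ : free σ ⊤ ≤ missing σ ⊤
    tight⊤ = ≤-trans (≤-reflexive (∑-zero _ (λ a → ⟦⟧-no (free? σ ⊤ a) (λ { (_ , _ , t) → t ∈⊤ })))) z≤n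
    decide : Dec (∃ λ c → ∃ λ v → ¬ In σ c v) → Goal
    decide (no all) = σ , (λ e → e) , deg , λ c v → reach c v (decidable-stable (in? σ c v) (λ ni → all (c , v , ni)))
    decide (yes (c , v , ¬in)) =
      grow (safe-arc σ cut c ⊤ (<-wellFounded _) (tight⊤ , o , ∈⊤ , inj₁ o∉T) (v , ∈⊤ , ¬in))

  record Complete (σ : State) : Set where
    field
      reached  : ∀ c v → Reached σ c v
      degree≥b : ∀ c v → v ∈ T → b v ≤ indeg σ c v

  -- A colour short at `v` makes the deficit there positive, so `Deg` supplies a free arc into `v`.
  -- Any such arc will do, as reachability is secured and adding arcs preserves it.
  fill : ∀ σ → Acc _<_ (uncoloured σ) → Deg σ → (∀ c v → Reached σ c v) → ∃ λ τ → σ ⊑ τ × Complete τ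
  fill σ (acc rs) deg reached = decide (any? (λ c → any? (λ v → (v ∈? T) ×-dec (indeg σ c v <? b v))))
    where
    Goal : Set
    Goal = ∃ λ τ → σ ⊑ τ × Complete τ
    decide : Dec (∃ λ c → ∃ λ v → v ∈ T × indeg σ c v < b v) → Goal
    decide (no none) = σ , (λ e → e) , record
      { reached = reached ; degree≥b = λ c v v∈ → ≮⇒≥ (λ lt → none (c , v , v∈ , lt)) }
    decide (yes (c , v , v∈T , lt)) = use (#-pos (free? σ ⁅ v ⁆)
        (<-≤-trans (m<n⇒0<n∸m lt) (≤-trans (∑-term≤ (λ c → b v ∸ indeg σ c v) c) (deg v v∈T))))
      where
      use : (∃ λ a → σ a ≡ nothing × Enters ⁅ v ⁆ a) → Goal
      use (a , fresh , ent) = weaken (fill (set σ a c) (rs (uncoloured-set-< fresh))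
          (Deg-set fresh (subst (λ w → indeg σ c w < b w) (sym (enters-⁅⁆⇒hd ent)) lt) deg)
          (λ c v → Reached-mono (set-⊑ fresh) (reached c v)))
        where
        weaken : (∃ λ τ → set σ a c ⊑ τ × Complete τ) → Goal
        weaken (τ , le , comp) = τ , (λ e → le (set-⊑ fresh e)) , comp

  complete : ∀ σ → Extendable σ → ∃ λ τ → σ ⊑ τ × Complete τ
  complete σ ext = finish (branchings σ (<-wellFounded _) ext)
    where
    finish : (∃ λ τ → σ ⊑ τ × Deg τ × (∀ c v → Reached τ c v)) → ∃ λ τ → σ ⊑ τ × Complete τ
    finish (τ , le , deg , reached) = extend (fill τ (<-wellFounded _) deg reached)
      where
      extend : (∃ λ υ → τ ⊑ υ × Complete υ) → ∃ λ υ → σ ⊑ υ × Complete υ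
      extend (υ , le′ , comp) = υ , (λ e → le′ (le e)) , comp

  -- Feasible colourings of the shared arcs

  private
    Col : Set
    Col = Fin m → Fin k

  abstract
    -- Only arcs entering `T` are shared by the two sides. A total colouring is read on these alone,
    -- and all other arcs count as free.
    restrict : Col → State
    restrict φ a = keep (enters? T a) (φ a)
      where
      keep : {P A : Set} → Dec P → A → Maybe A
      keep (yes _) x = just x
      keep (no _) _ = nothing

    restrict-root : ∀ {φ a} → Enters T a → restrict φ a ≡ just (φ a)
    restrict-root {a = a} r with enters? T a
    ... | yes _ = refl
    ... | no ¬r = ⊥-elim (¬r r)

    restrict-nonroot : ∀ {φ a} → ¬ Enters T a → restrict φ a ≡ nothing
    restrict-nonroot {a = a} ¬r with enters? T a
    ... | yes r = ⊥-elim (¬r r)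
    ... | no _ = refl

    restrict-just : ∀ {φ a c} → restrict φ a ≡ just c → Enters T a × φ a ≡ c
    restrict-just {a = a} eq with enters? T a
    restrict-just eq | yes r = r , just-injective eq
    restrict-just () | no _

    restrict-nothing : ∀ {φ a} → restrict φ a ≡ nothing → ¬ Enters T a
    restrict-nothing {a = a} eq with enters? T a
    restrict-nothing () | yes _
    restrict-nothing eq | no ¬r = ¬r

  Feasible : Col → Set
  Feasible φ = Cut (restrict φ) × Deg (restrict φ)

  -- Coloured arcs start outside `T`, at roots, so every path needed has at most one arc.
  feasible⇒extendable : ∀ {φ} → Feasible φ → Extendable (restrict φ)
  feasible⇒extendable {φ} (cut , deg) = record { reach = reach ; cut = cut ; deg = deg }
    where
    reach : ∀ c v → In (restrict φ) c v → Reached (restrict φ) c v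
    reach c v (inj₁ v∉) = root v∉
    reach c v (inj₂ (a , eq , refl)) = arc a eq (root (proj₂ (proj₁ (restrict-just eq))))

  -- A vertex of `U` outside `T` is a root of every colour, which makes `missing` vanish; only
  -- subsets of `T` need an argument.
  bound-missing : ∀ σ U x → (U ⊆ T → missing σ U ≤ x) → missing σ U ≤ x
  bound-missing σ U x inner = split (any? (λ v → (v ∈? U) ×-dec ¬? (v ∈? T)))
    where
    split : Dec (∃ λ v → v ∈ U × v ∉ T) → missing σ U ≤ x
    split (yes (v , v∈ , v∉)) =
      ≤-trans (≤-reflexive (∑-zero _ (λ c → ⟦⟧-no (¬? (touch? σ U c)) (λ ¬t → ¬t (v , v∈ , inj₁ v∉))))) z≤n
    split (no none) = inner (λ {v} v∈ → decidable-stable (v ∈? T) (λ v∉ → none (v , v∈ , v∉)))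

  ∅ : State
  ∅ _ = nothing

  -- Before any arc is coloured, the demand is at most `k` at a set and `k * b v` at a vertex, so
  -- the bicut and degree bounds suffice.
  ∅-extendable : (∀ U → Nonempty U → U ⊆ T → k ≤ free ∅ U) →
                 (∀ v → v ∈ T → k * b v ≤ free ∅ ⁅ v ⁆) → Extendable ∅
  ∅-extendable hcut hdeg = record { reach = reach ; cut = cut ; deg = deg }
    where
    reach : ∀ c v → In ∅ c v → Reached ∅ c v
    reach c v (inj₁ v∉) = root v∉
    reach c v (inj₂ (_ , () , _))
    cut : Cut ∅
    cut U ne = bound-missing ∅ U _ λ U⊆T → ≤-trans (∑-mono (λ c → ⟦⟧≤1 (¬? (touch? ∅ U c))))
      (≤-trans (≤-reflexive (trans (∑-const k 1) (*-identityʳ k))) (hcut U ne U⊆T))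
    deg : Deg ∅
    deg v v∈T = ≤-trans (∑-mono (λ c → m∸n≤m (b v) (indeg ∅ c v)))
                        (≤-trans (≤-reflexive (∑-const k (b v))) (hdeg v v∈T))

  entering-arc : ∀ {σ c v} U → U ⊆ T → v ∈ U → Reached σ c v → ∃ λ a → σ a ≡ just c × Enters U a
  entering-arc U U⊆T v∈ (root v∉) = ⊥-elim (v∉ (U⊆T v∈))
  entering-arc U U⊆T v∈ (arc a eq r) with tl a ∈? U
  ... | yes t∈ = entering-arc U U⊆T t∈ r
  ... | no t∉ = a , eq , v∈ , t∉

  -- Necessity of the conditions. In `τ` each colour enters `U`; if the shared arcs of that colour
  -- do not, one of its other arcs does, and different colours use different arcs. The same count
  -- bounds the deficits. `χ` may be arbitrary where `τ` is undefined.
  complete⇒feasible : ∀ {τ χ} → Complete τ → (∀ {a c} → τ a ≡ just c → χ a ≡ c) → Feasible χ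
  complete⇒feasible {τ} {χ} comp τ⇒χ = cut , deg
    where
    open Complete comp
    σ : State
    σ = restrict χ
    fib : Subset n → Fin k → ℕ
    fib U c = # (fibre? (free? σ U) χ c)
    cut : Cut σ
    cut U (v , v∈) = bound-missing σ U _ λ U⊆T → ≤-trans (∑-mono (each U⊆T)) (∑-fibres (free? σ U) χ)
      where
      each : U ⊆ T → ∀ c → miss σ U c ≤ fib U c
      each U⊆T c = split (touch? σ U c)
        where
        split : Dec (Touch σ U c) → miss σ U c ≤ fib U c
        split (yes t) = ≤-trans (≤-reflexive (⟦⟧-no (¬? (touch? σ U c)) (λ ¬t → ¬t t))) z≤n
        split (no ¬t) = ≤-trans (⟦⟧≤1 (¬? (touch? σ U c))) (found (entering-arc U U⊆T v∈ (reached c v)))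
          where
          found : (∃ λ a → τ a ≡ just c × Enters U a) → 1 ≤ fib U c
          found (a , eq , en) = #-witness (fibre? (free? σ U) χ c) a
            ((restrict-nonroot (λ r → ¬t (hd a , proj₁ en , inj₂ (a , trans (restrict-root r) (cong just (τ⇒χ eq)) , refl)))
             , en) , τ⇒χ eq)
    deg : Deg σ
    deg v v∈T = ≤-trans (∑-mono (λ c → m≤n+o⇒m∸n≤o (b v) (indeg σ c v) (≤-trans (degree≥b c v v∈T) (each c))))
                        (∑-fibres (free? σ ⁅ v ⁆) χ)
      where
      each : ∀ c → indeg τ c v ≤ indeg σ c v + fib ⁅ v ⁆ c
      each c = subst (indeg τ c v ≤_)
        (∑-distrib-+ (λ a → ⟦ indeg? σ c v a ⟧) (λ a → ⟦ fibre? (free? σ ⁅ v ⁆) χ c a ⟧))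
        (∑-mono (λ a → split a (enters? T a)))
        where
        split : ∀ a → Dec (Enters T a) →
                ⟦ indeg? τ c v a ⟧ ≤ ⟦ indeg? σ c v a ⟧ + ⟦ fibre? (free? σ ⁅ v ⁆) χ c a ⟧
        split a (yes r) = ≤-trans (⟦⟧-mono (indeg? τ c v a) (indeg? σ c v a)
          (λ { (eq , en) → trans (restrict-root r) (cong just (τ⇒χ eq)) , en })) (m≤m+n _ _)
        split a (no ¬r) = ≤-trans (⟦⟧-mono (indeg? τ c v a) (fibre? (free? σ ⁅ v ⁆) χ c a)
          (λ { (eq , en) → (restrict-nonroot ¬r , en) , τ⇒χ eq })) (m≤n+m _ _)

  -- Kempe changes of a feasible colouring

  module Exchange (φ : Col) (feasible : Feasible φ) (i j : Fin k) (i≢j : i ≢ j) where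

    σ : State
    σ = restrict φ

    cut : Cut σ
    cut = proj₁ feasible

    others : Subset n → ℕ
    others U = sum (rest i j (miss σ U))

    missing-split : ∀ U → missing σ U ≡ others U + (miss σ U i + miss σ U j)
    missing-split U = ∑-rest (miss σ U) i≢j

    others≤free : ∀ U → Nonempty U → others U ≤ free σ U
    others≤free U ne = ≤-trans (m≤m+n _ _) (≤-trans (≤-reflexive (sym (missing-split U))) (cut U ne))

    -- In a critical set the colours other than i and j leave no slack, so an exchange of i and j
    -- must keep both of them on arcs entering it.
    Critical : Subset n → Set
    Critical U = Nonempty U × U ⊆ T × free σ U ≤ others U

    critical? : ∀ U → Dec (Critical U)
    critical? U = nonempty? U ×-dec (U ⊆? T) ×-dec (free σ U ≤? others U)

    -- The uncrossing of tight sets again, with the terms of `i` and `j` left out of the sum.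
    ∩-critical : ∀ {U W v} → v ∈ U ∩ W → Critical U → Critical W → Critical (U ∩ W)
    ∩-critical {U} {W} {v} v∈ (_ , U⊆ , cU) (_ , _ , cW) =
      (v , v∈) , U⊆ ∘ proj₁ ∘ x∈p∩q⁻ U W , +-cancelʳ-≤ (free σ (U ∪ W)) _ _ (begin
        free σ (U ∩ W) + free σ (U ∪ W) ≤⟨ free-submodular σ U W ⟩
        free σ U + free σ W             ≤⟨ +-mono-≤ cU cW ⟩
        others U + others W             ≤⟨ ∑-mono₂ (rest-mono₂ {i = i} {j} (miss-supermodular σ U W)) ⟩
        others (U ∩ W) + others (U ∪ W) ≤⟨ +-monoʳ-≤ (others (U ∩ W)) (others≤free (U ∪ W) (v , v∈∪)) ⟩
        others (U ∩ W) + free σ (U ∪ W) ∎)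
      where
      open ≤-Reasoning
      v∈∪ : v ∈ U ∪ W
      v∈∪ = x∈p∪q⁺ (inj₁ (proj₁ (x∈p∩q⁻ U W v∈)))

    MinCritical : Subset n → Set
    MinCritical M = Critical M × ¬ (∃ λ W → Critical W × W ⊂ M)

    smaller? : ∀ M → Dec (∃ λ W → Critical W × W ⊂ M)
    smaller? M = anySubset? (λ W → critical? W ×-dec (W ⊂? M))

    minCritical? : ∀ M → Dec (MinCritical M)
    minCritical? M = critical? M ×-dec ¬? (smaller? M)

    minCritical-below : ∀ U → Acc _<_ ∣ U ∣ → Critical U → ∃ λ M → M ⊆ U × MinCritical M
    minCritical-below U (acc rs) crit = decide (smaller? U)
      where
      decide : Dec (∃ λ W → Critical W × W ⊂ U) → ∃ λ M → M ⊆ U × MinCritical M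
      decide (no ¬s) = U , id , crit , ¬s
      decide (yes (W , cW , W⊂U)) = widen (minCritical-below W (rs (p⊂q⇒∣p∣<∣q∣ W⊂U)) cW)
        where
        widen : (∃ λ M → M ⊆ W × MinCritical M) → ∃ λ M → M ⊆ U × MinCritical M
        widen (M , M⊆W , mc) = M , proj₁ W⊂U ∘ M⊆W , mc

    -- Otherwise the intersection would be a smaller critical set. In particular, distinct minimal
    -- critical sets are disjoint.
    minCritical-⊆ : ∀ {M W v} → MinCritical M → Critical W → v ∈ M → v ∈ W → M ⊆ W
    minCritical-⊆ {M} {W} (cM , ¬s) cW v∈M v∈W {x} x∈M = decidable-stable (x ∈? W) λ x∉W →
      ¬s (M ∩ W , ∩-critical (x∈p∩q⁺ (v∈M , v∈W)) cM cW ,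
          proj₁ ∘ x∈p∩q⁻ M W , x , x∈M , x∉W ∘ proj₂ ∘ x∈p∩q⁻ M W)

    Special : Fin m → Set
    Special a = Enters T a × (φ a ≡ i ⊎ φ a ≡ j)

    special? : Decidable Special
    special? a = enters? T a ×-dec ((φ a ≟ᶠ i) ⊎-dec (φ a ≟ᶠ j))

    -- Pairs with a common head balance i against j at every vertex, which minimises the deficit there.
    SameHead SameCritical : Fin m → Fin m → Set
    SameHead a e = Special a × Special e × hd a ≡ hd e
    SameCritical a e = Special a × Special e × ∃ λ M → MinCritical M × hd a ∈ M × hd e ∈ M

    sameCritical-sym : ∀ {a e} → SameCritical a e → SameCritical e a
    sameCritical-sym (s , s′ , M , mc , p , q) = s′ , s , M , mc , q , p

    abstract
      headPairs : Greedy SameHead (allFin m)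
      headPairs = pairUp (λ a e → special? a ×-dec special? e ×-dec (hd a ≟ᶠ hd e)) (allFin m)

    open Greedy headPairs using () renaming (pairs to P₁; left to L₁; perm to perm₁; related to rel₁; unrelated to unrel₁)

    abstract
      -- Only arcs left over by `headPairs` are paired here, so the two lists of pairs together form
      -- one matching.
      critPairs : Greedy SameCritical L₁
      critPairs = pairUp (λ a e → special? a ×-dec special? e ×-dec
        anySubset? (λ M → minCritical? M ×-dec (hd a ∈? M) ×-dec (hd e ∈? M))) L₁

    open Greedy critPairs using () renaming (pairs to P₂; left to L₂; perm to perm₂; related to rel₂; unrelated to unrel₂)

    pairs : List (Fin m × Fin m)
    pairs = P₁ ++ P₂

    pairs-unique : Unique (flat pairs)
    pairs-unique = subst Unique (sym (flat-++ P₁ P₂))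
      (Unique-++ˡ (flat P₁ ++ flat P₂) (Unique-resp-↭ (↭-trans (↭-sym perm₁) (↭-trans (++⁺ˡ (flat P₁) (↭-sym perm₂))
        (subst (λ l → flat P₁ ++ flat P₂ ++ L₂ ↭ l) (sym (++-assoc (flat P₁) (flat P₂) L₂)) refl))) (allFin⁺ m)))

    InPair : Subset n → Set
    InPair M = ∃ λ x → ∃ λ y → (x , y) ∈ˡ pairs × (Special x × hd x ∈ M) × (Special y × hd y ∈ M)

    coloured-arc : ∀ {U c} → U ⊆ T → Touch σ U c → ∃ λ a → Enters T a × φ a ≡ c × hd a ∈ U
    coloured-arc U⊆T (v , v∈ , inj₁ v∉) = ⊥-elim (v∉ (U⊆T v∈))
    coloured-arc U⊆T (v , v∈ , inj₂ (a , eq , refl)) = a , proj₁ (restrict-just eq) , proj₂ (restrict-just eq) , v∈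

    -- The cut condition and criticality squeeze the terms of `i` and `j` to zero.
    critical-touched : ∀ {U} → Critical U → Touch σ U i × Touch σ U j
    critical-touched {U} (ne , _ , tight) = touched (m≤m+n _ _) , touched (m≤n+m _ _)
      where
      none : miss σ U i + miss σ U j ≤ 0
      none = +-cancelˡ-≤ (others U) _ _ (begin
        others U + (miss σ U i + miss σ U j) ≡⟨ sym (missing-split U) ⟩
        missing σ U                          ≤⟨ cut U ne ⟩
        free σ U                             ≤⟨ tight ⟩
        others U                             ≡⟨ sym (+-identityʳ _) ⟩
        others U + 0                         ∎)
        where open ≤-Reasoning
      touched : ∀ {c} → miss σ U c ≤ miss σ U i + miss σ U j → Touch σ U c
      touched {c} le = decidable-stable (touch? σ U c) λ ¬t →
        <⇒≱ (s≤s z≤n) (≤-trans (≤-reflexive (sym (⟦⟧-yes (¬? (touch? σ U c)) ¬t))) (≤-trans le none))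

    -- Arcs of colours `i` and `j` have their heads in `M`. If one of them is paired, its partner
    -- also has its head in `M`: either the heads coincide, or they share a minimal critical set
    -- that meets `M` and so lies inside it. If both were left over, they would be related, against
    -- maximality.
    minCritical-pair : ∀ {M} → MinCritical M → InPair M
    minCritical-pair {M} mc@(crit@(_ , M⊆T , _) , _) =
      search (coloured-arc M⊆T (proj₁ (critical-touched crit))) (coloured-arc M⊆T (proj₂ (critical-touched crit)))
      where
      inP₁ : ∀ {a} → hd a ∈ M → a ∈ˡ flat P₁ → InPair M
      inP₁ h∈ a∈ with ∈-flat⁻ P₁ a∈
      ... | y , inj₁ p with All.lookup rel₁ p
      ... | s , s′ , eq = _ , y , ∈-++⁺ˡ p , (s , h∈) , (s′ , subst (_∈ M) eq h∈)
      inP₁ h∈ a∈ | y , inj₂ p with All.lookup rel₁ p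
      ... | s , s′ , eq = y , _ , ∈-++⁺ˡ p , (s , subst (_∈ M) (sym eq) h∈) , (s′ , h∈)
      inP₂ : ∀ {a} → hd a ∈ M → a ∈ˡ flat P₂ → InPair M
      inP₂ h∈ a∈ with ∈-flat⁻ P₂ a∈
      ... | y , inj₁ p with All.lookup rel₂ p
      ... | s , s′ , W , mW , q , q′ = _ , y , ∈-++⁺ʳ P₁ p , (s , h∈) , (s′ , minCritical-⊆ mW crit q h∈ q′)
      inP₂ h∈ a∈ | y , inj₂ p with All.lookup rel₂ p
      ... | s , s′ , W , mW , q , q′ = y , _ , ∈-++⁺ʳ P₁ p , (s , minCritical-⊆ mW crit q′ h∈ q) , (s′ , h∈)
      locate : ∀ {a} → hd a ∈ M → InPair M ⊎ a ∈ˡ L₂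
      locate {a} h∈ with ∈-++⁻ (flat P₁) (∈-resp-↭ (↭-sym perm₁) (∈-allFin a))
      ... | inj₁ p = inj₁ (inP₁ h∈ p)
      ... | inj₂ q with ∈-++⁻ (flat P₂) (∈-resp-↭ (↭-sym perm₂) q)
      ... | inj₁ p = inj₁ (inP₂ h∈ p)
      ... | inj₂ r = inj₂ r
      search : (∃ λ a → Enters T a × φ a ≡ i × hd a ∈ M) → (∃ λ e → Enters T e × φ e ≡ j × hd e ∈ M) → InPair M
      search (a , ra , ia , ha) (e , re , je , he) with locate ha | locate he
      ... | inj₁ p | _ = p
      ... | _ | inj₁ p = p
      ... | inj₂ a∈ | inj₂ e∈ = ⊥-elim ([ (λ ¬r → ¬r related) , (λ ¬r → ¬r (sameCritical-sym related)) ]′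
            (AllPairs-lookup unrel₂ a∈ e∈ (λ { refl → i≢j (trans (sym ia) je) })))
        where
        related : SameCritical a e
        related = (ra , inj₁ ia) , (re , inj₂ je) , M , mc , ha , he

    module Recoloured (ψ : Fin m → Bool) (bi : Bichromatic ψ pairs) where

      φ′ : Col
      φ′ = recolour i j ψ φ

      σ′ : State
      σ′ = restrict φ′

      recoloured-special : ∀ {a} → Special a → σ′ a ≡ just (if ψ a then i else j)
      recoloured-special {a} (r , s) = trans (restrict-root r) (cong just (recolour-on ψ φ a s))

      special⁻ : ∀ {a} → Enters T a → φ′ a ≡ i ⊎ φ′ a ≡ j → Special a
      special⁻ {a} r s with special? a
      ... | yes p = p
      ... | no ¬p = r , [ (λ e → inj₁ (trans (sym same) e)) , (λ e → inj₂ (trans (sym same) e)) ]′ s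
        where
        same : φ′ a ≡ φ a
        same = recolour-off ψ φ a (λ e → ¬p (r , inj₁ e)) (λ e → ¬p (r , inj₂ e))

      recoloured-other : ∀ {a c} → c ≢ i → c ≢ j → (σ a ≡ just c → σ′ a ≡ just c) × (σ′ a ≡ just c → σ a ≡ just c)
      recoloured-other {a} {c} ni nj = to , from
        where
        to : σ a ≡ just c → σ′ a ≡ just c
        to eq with restrict-just eq
        ... | r , refl = trans (restrict-root r) (cong just (recolour-off ψ φ a ni nj))
        from : σ′ a ≡ just c → σ a ≡ just c
        from eq with restrict-just eq
        ... | r , e = trans (restrict-root r) (cong just (trans (sym (recolour-off ψ φ a
                (λ p → off (inj₁ p)) (λ p → off (inj₂ p)))) e))
          where
          off : ¬ (φ a ≡ i ⊎ φ a ≡ j)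
          off s with ψ a | trans (sym (recolour-on ψ φ a s)) e
          ... | true | p = ni (sym p)
          ... | false | p = nj (sym p)

      free-same : ∀ U → free σ′ U ≡ free σ U
      free-same U = sum-cong-≗ λ a → ⟦⟧-cong (free? σ′ U a) (free? σ U a)
        (λ { (f , en) → restrict-nonroot (restrict-nothing f) , en })
        (λ { (f , en) → restrict-nonroot (restrict-nothing f) , en })

      others-same : ∀ U → sum (rest i j (miss σ′ U)) ≡ others U
      others-same U = sum-cong-≗ (rest-cong {i = i} {j} (λ c ni nj →
        ⟦⟧-cong (¬? (touch? σ′ U c)) (¬? (touch? σ U c))
          (λ ¬t → ¬t ∘ move (proj₁ (recoloured-other ni nj)))
          (λ ¬t → ¬t ∘ move (proj₂ (recoloured-other ni nj)))))
        where
        move : ∀ {ρ ρ′ c} → (∀ {a} → ρ a ≡ just c → ρ′ a ≡ just c) → Touch ρ U c → Touch ρ′ U c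
        move f (v , v∈ , inj₁ v∉) = v , v∈ , inj₁ v∉
        move f (v , v∈ , inj₂ (a , eq , h)) = v , v∈ , inj₂ (a , f eq , h)

      missing-split′ : ∀ U → missing σ′ U ≡ others U + (miss σ′ U i + miss σ′ U j)
      missing-split′ U = trans (∑-rest (miss σ′ U) i≢j) (cong (_+ (miss σ′ U i + miss σ′ U j)) (others-same U))

      touch-special : ∀ {U a} → Special a → hd a ∈ U → Touch σ′ U (if ψ a then i else j)
      touch-special {a = a} s h∈ = hd a , h∈ , inj₂ (a , recoloured-special s , refl)

      -- A minimal critical set inside `U` contains the heads of a pair, whose two arcs receive `i`
      -- and `j`.
      critical-touched′ : ∀ {U} → Critical U → Touch σ′ U i × Touch σ′ U j
      critical-touched′ {U} crit = go (minCritical-below U (<-wellFounded _) crit)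
        where
        go : (∃ λ M → M ⊆ U × MinCritical M) → Touch σ′ U i × Touch σ′ U j
        go (M , M⊆U , mc) with minCritical-pair mc
        ... | x , y , p , (sx , hx) , (sy , hy)
            with ψ x | ψ y | All.lookup bi p | touch-special sx (M⊆U hx) | touch-special sy (M⊆U hy)
        ... | true | true | ne | _ | _ = ⊥-elim (ne refl)
        ... | true | false | _ | ti | tj = ti , tj
        ... | false | true | _ | tj | ti = ti , tj
        ... | false | false | ne | _ | _ = ⊥-elim (ne refl)

      miss-touched : ∀ {U c} → Touch σ′ U c → miss σ′ U c ≡ 0
      miss-touched {U} {c} t = ⟦⟧-no (¬? (touch? σ′ U c)) (λ ¬t → ¬t t)

      miss≤1 : ∀ U c → miss σ′ U c ≤ 1
      miss≤1 U c = ⟦⟧≤1 (¬? (touch? σ′ U c))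

      -- In a critical set neither `i` nor `j` is missing. Any other subset of `T` has a slack of at
      -- least one over `others`, enough for one missing colour. If both are missing, no special arc
      -- has its head in `U`, so both were missing before and the old inequality applies.
      cut′ : Cut σ′
      cut′ U ne = bound-missing σ′ U _ λ U⊆T →
        subst₂ _≤_ (sym (missing-split′ U)) (sym (free-same U)) (bound U⊆T)
        where
        one : others U < free σ U → ∀ {x y} → x ≡ 0 → y ≤ 1 → others U + (x + y) ≤ free σ U
        one lt refl le = ≤-trans (+-monoʳ-≤ (others U) le) (≤-trans (≤-reflexive (+-comm _ 1)) lt)
        bound : U ⊆ T → others U + (miss σ′ U i + miss σ′ U j) ≤ free σ U
        bound U⊆T = decide (free σ U ≤? others U) (touch? σ′ U i) (touch? σ′ U j)
          where
          untouched : ¬ Touch σ′ U i → ¬ Touch σ′ U j → ∀ {a} → Special a → hd a ∈ U → ⊥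
          untouched ¬ti ¬tj {a} s h∈ with ψ a | touch-special s h∈
          ... | true | t = ¬ti t
          ... | false | t = ¬tj t
          decide : Dec (free σ U ≤ others U) → Dec (Touch σ′ U i) → Dec (Touch σ′ U j) →
                   others U + (miss σ′ U i + miss σ′ U j) ≤ free σ U
          decide (yes tight) _ _ = ≤-trans (≤-reflexive (trans
              (cong (others U +_) (cong₂ _+_ (miss-touched (proj₁ both)) (miss-touched (proj₂ both)))) (+-identityʳ _)))
              (others≤free U ne)
            where
            both : Touch σ′ U i × Touch σ′ U j
            both = critical-touched′ (ne , U⊆T , tight)
          decide (no loose) (yes ti) _ = one (≰⇒> loose) (miss-touched ti) (miss≤1 U j)
          decide (no loose) (no _) (yes tj) =
            subst (λ x → others U + x ≤ free σ U) (+-comm (miss σ′ U j) _) (one (≰⇒> loose) (miss-touched tj) (miss≤1 U i))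
          decide (no _) (no ¬ti) (no ¬tj) = begin
            others U + (miss σ′ U i + miss σ′ U j) ≤⟨ +-monoʳ-≤ (others U) (+-mono-≤ (old i inj₁) (old j inj₂)) ⟩
            others U + (miss σ U i + miss σ U j)   ≡⟨ sym (missing-split U) ⟩
            missing σ U                            ≤⟨ cut U ne ⟩
            free σ U                               ∎
            where
            open ≤-Reasoning
            old : ∀ c → (∀ {a} → φ a ≡ c → φ a ≡ i ⊎ φ a ≡ j) → miss σ′ U c ≤ miss σ U c
            old c f = ⟦⟧-mono (¬? (touch? σ′ U c)) (¬? (touch? σ U c)) λ _ t → no-arc (coloured-arc U⊆T t)
              where
              no-arc : (∃ λ a → Enters T a × φ a ≡ c × hd a ∈ U) → ⊥
              no-arc (a , r , e , h∈) = untouched ¬ti ¬tj (r , f e) h∈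

      indeg-other : ∀ c v → c ≢ i → c ≢ j → indeg σ′ c v ≡ indeg σ c v
      indeg-other c v ni nj = sum-cong-≗ λ a → ⟦⟧-cong (indeg? σ′ c v a) (indeg? σ c v a)
        (λ { (eq , en) → proj₂ (recoloured-other ni nj) eq , en })
        (λ { (eq , en) → proj₁ (recoloured-other ni nj) eq , en })

      -- An exchange permutes `i` and `j` only within the special arcs, so counting those at `v`
      -- gives a total common to `φ` and `φ′`.
      indeg-sum : ∀ χ → (∀ a → Enters T a → (χ a ≡ i ⊎ χ a ≡ j → Special a) × (Special a → χ a ≡ i ⊎ χ a ≡ j)) → ∀ v →
                  indeg (restrict χ) i v + indeg (restrict χ) j v ≡ # (λ a → special? a ×-dec enters? ⁅ v ⁆ a)
      indeg-sum χ h v = trans (sym (∑-distrib-+ (λ a → ⟦ indeg? (restrict χ) i v a ⟧) (λ a → ⟦ indeg? (restrict χ) j v a ⟧)))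
                                (sum-cong-≗ each)
        where
        ρ : State
        ρ = restrict χ
        each : ∀ a → ⟦ indeg? ρ i v a ⟧ + ⟦ indeg? ρ j v a ⟧ ≡ ⟦ special? a ×-dec enters? ⁅ v ⁆ a ⟧
        each a = split (ρ a ≟ᵐ just i)
          where
          split : Dec (ρ a ≡ just i) → ⟦ indeg? ρ i v a ⟧ + ⟦ indeg? ρ j v a ⟧ ≡ ⟦ special? a ×-dec enters? ⁅ v ⁆ a ⟧
          split (yes eq) = trans (cong₂ _+_
              (⟦⟧-cong (indeg? ρ i v a) (special? a ×-dec enters? ⁅ v ⁆ a)
                (λ { (_ , en) → proj₁ (h a r) (inj₁ e) , en }) (λ { (_ , en) → eq , en }))
              (⟦⟧-no (indeg? ρ j v a) (λ { (eq′ , _) → i≢j (just-injective (trans (sym eq) eq′)) })))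
              (+-identityʳ _)
            where
            r = proj₁ (restrict-just eq)
            e = proj₂ (restrict-just eq)
          split (no ne) = cong₂ _+_
              (⟦⟧-no (indeg? ρ i v a) (ne ∘ proj₁))
              (⟦⟧-cong (indeg? ρ j v a) (special? a ×-dec enters? ⁅ v ⁆ a)
                (λ { (eq , en) → proj₁ (h a (proj₁ (restrict-just eq))) (inj₂ (proj₂ (restrict-just eq))) , en })
                (λ { (s , en) → [ (λ e → ⊥-elim (ne (trans (restrict-root (proj₁ s)) (cong just e))))
                                , (λ e → trans (restrict-root (proj₁ s)) (cong just e)) ]′ (proj₂ (h a (proj₁ s)) s) , en }))

      indeg-list : ∀ c v → indeg σ′ c v ≡ ∑ᴸ (λ a → ⟦ indeg? σ′ c v a ⟧) (flat P₁) + ∑ᴸ (λ a → ⟦ indeg? σ′ c v a ⟧) L₁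
      indeg-list c v = trans (sym (∑ᴸ-tabulate f id)) (trans (sym (∑ᴸ-↭ f perm₁)) (∑ᴸ-++ f (flat P₁) L₁))
        where
        f : Fin m → ℕ
        f a = ⟦ indeg? σ′ c v a ⟧

      -- The arcs of a pair have the same head and opposite colours, so each pair contributes
      -- equally to `i` and `j` at every vertex.
      pairs-balanced : ∀ v → ∑ᴸ (λ a → ⟦ indeg? σ′ i v a ⟧) (flat P₁) ≡ ∑ᴸ (λ a → ⟦ indeg? σ′ j v a ⟧) (flat P₁)
      pairs-balanced v = ∑ᴸ-flat (λ a → ⟦ indeg? σ′ i v a ⟧) (λ a → ⟦ indeg? σ′ j v a ⟧) P₁ (All.tabulate each)
        where
        colour : ∀ {a} c → Special a → hd a ≡ v → (if ψ a then i else j) ≡ c → ⟦ indeg? σ′ c v a ⟧ ≡ 1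
        colour {a} c s h eq = ⟦⟧-yes (indeg? σ′ c v a) (trans (recoloured-special s) (cong just eq) , enters-⁅hd⁆ h)
        uncolour : ∀ {a} c → Special a → (if ψ a then i else j) ≢ c → ⟦ indeg? σ′ c v a ⟧ ≡ 0
        uncolour {a} c s ne = ⟦⟧-no (indeg? σ′ c v a) (λ { (eq , _) →
          ne (just-injective (trans (sym (recoloured-special s)) eq)) })
        away : ∀ {a} c → hd a ≢ v → ⟦ indeg? σ′ c v a ⟧ ≡ 0
        away {a} c ne = ⟦⟧-no (indeg? σ′ c v a) (λ { (_ , en) → ne (enters-⁅⁆⇒hd en) })
        each : ∀ {p} → p ∈ˡ P₁ → ⟦ indeg? σ′ i v (proj₁ p) ⟧ + ⟦ indeg? σ′ i v (proj₂ p) ⟧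
                               ≡ ⟦ indeg? σ′ j v (proj₁ p) ⟧ + ⟦ indeg? σ′ j v (proj₂ p) ⟧
        each {x , y} p∈ = split (hd x ≟ᶠ v)
          where
          rel : SameHead x y
          rel = All.lookup rel₁ p∈
          sx = proj₁ rel
          sy = proj₁ (proj₂ rel)
          split : Dec (hd x ≡ v) → ⟦ indeg? σ′ i v x ⟧ + ⟦ indeg? σ′ i v y ⟧ ≡ ⟦ indeg? σ′ j v x ⟧ + ⟦ indeg? σ′ j v y ⟧
          split (no ne) = trans (cong₂ _+_ (away i ne) (away i ne′)) (sym (cong₂ _+_ (away j ne) (away j ne′)))
            where
            ne′ : hd y ≢ v
            ne′ e = ne (trans (proj₂ (proj₂ rel)) e)
          split (yes e) = opposite (ψ x) (ψ y) refl refl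
            where
            e′ : hd y ≡ v
            e′ = trans (sym (proj₂ (proj₂ rel))) e
            i′ : ∀ {a} → ψ a ≡ true → (if ψ a then i else j) ≡ i
            i′ eq rewrite eq = refl
            j′ : ∀ {a} → ψ a ≡ false → (if ψ a then i else j) ≡ j
            j′ eq rewrite eq = refl
            opposite : ∀ s t → ψ x ≡ s → ψ y ≡ t →
                       ⟦ indeg? σ′ i v x ⟧ + ⟦ indeg? σ′ i v y ⟧ ≡ ⟦ indeg? σ′ j v x ⟧ + ⟦ indeg? σ′ j v y ⟧
            opposite true true p q = ⊥-elim (All.lookup bi (∈-++⁺ˡ p∈) (trans p (sym q)))
            opposite false false p q = ⊥-elim (All.lookup bi (∈-++⁺ˡ p∈) (trans p (sym q)))
            opposite true false p q = trans
              (cong₂ _+_ (colour i sx e (i′ p)) (uncolour i sy (λ r → i≢j (trans (sym r) (j′ q)))))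
              (sym (cong₂ _+_ (uncolour j sx (λ r → i≢j (trans (sym (i′ p)) r))) (colour j sy e′ (j′ q))))
            opposite false true p q = trans
              (cong₂ _+_ (uncolour i sx (λ r → i≢j (trans (sym r) (j′ p)))) (colour i sy e′ (i′ q)))
              (sym (cong₂ _+_ (colour j sx e (j′ p)) (uncolour j sy (λ r → i≢j (trans (sym (i′ q)) r)))))

      leftover≤1 : ∀ c v → c ≡ i ⊎ c ≡ j → ∑ᴸ (λ a → ⟦ indeg? σ′ c v a ⟧) L₁ ≤ 1
      leftover≤1 c v ij = ∑ᴸ-≤1 (indeg? σ′ c v) (λ { (p , en) (p′ , en′) →
          special p , special p′ , trans (enters-⁅⁆⇒hd en) (sym (enters-⁅⁆⇒hd en′)) }) unrel₁
        where
        special : ∀ {a} → σ′ a ≡ just c → Special a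
        special eq with restrict-just eq
        ... | r , e = special⁻ r ([ (λ c≡ → inj₁ (trans e c≡)) , (λ c≡ → inj₂ (trans e c≡)) ]′ ij)

      balanced : ∀ v → indeg σ′ i v ≤ suc (indeg σ′ j v) × indeg σ′ j v ≤ suc (indeg σ′ i v)
      balanced v = near (indeg-list i v) (indeg-list j v) (pairs-balanced v) (leftover≤1 i v (inj₁ refl))
                 , near (indeg-list j v) (indeg-list i v) (sym (pairs-balanced v)) (leftover≤1 j v (inj₂ refl))
        where
        near : ∀ {x y p q l r} → x ≡ p + l → y ≡ q + r → p ≡ q → l ≤ 1 → x ≤ suc y
        near {p = p} refl refl refl le = ≤-trans (+-monoʳ-≤ p le) (≤-trans (≤-reflexive (+-comm p 1)) (s≤s (m≤m+n p _)))

      -- Other colours keep their indegrees. For `i` and `j` the total at `v` is unchanged and now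
      -- split as evenly as possible, so their deficit cannot grow.
      deg′ : Deg σ′
      deg′ v v∈T = begin
        deficit σ′ v
          ≡⟨ ∑-rest (λ c → b v ∸ indeg σ′ c v) i≢j ⟩
        sum (rest i j (λ c → b v ∸ indeg σ′ c v)) + ((b v ∸ indeg σ′ i v) + (b v ∸ indeg σ′ j v))
          ≤⟨ +-mono-≤ (≤-reflexive (sum-cong-≗ (rest-cong {i = i} {j} (λ c ni nj → cong (b v ∸_) (indeg-other c v ni nj)))))
                      (∸-balanced (b v) (indeg σ′ i v) (indeg σ′ j v) (indeg σ i v) (indeg σ j v)
                                  (proj₁ (balanced v)) (proj₂ (balanced v)) same) ⟩
        sum (rest i j (λ c → b v ∸ indeg σ c v)) + ((b v ∸ indeg σ i v) + (b v ∸ indeg σ j v))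
          ≡⟨ sym (∑-rest (λ c → b v ∸ indeg σ c v) i≢j) ⟩
        deficit σ v
          ≤⟨ proj₂ feasible v v∈T ⟩
        free σ ⁅ v ⁆
          ≡⟨ sym (free-same ⁅ v ⁆) ⟩
        free σ′ ⁅ v ⁆ ∎
        where
        open ≤-Reasoning
        on : ∀ a → Special a → φ′ a ≡ i ⊎ φ′ a ≡ j
        on a s with ψ a | recolour-on ψ φ a (proj₂ s)
        ... | true | e = inj₁ e
        ... | false | e = inj₂ e
        same : indeg σ′ i v + indeg σ′ j v ≡ indeg σ i v + indeg σ j v
        same = trans (indeg-sum φ′ (λ a r → special⁻ r , on a) v)
                       (sym (indeg-sum φ (λ a r → (r ,_) , proj₂) v))

  feasible-exchangeable : Exchangeable Feasible
  feasible-exchangeable φ feas i j i≢j = pairs , pairs-unique , λ ψ bi →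
    Recoloured.cut′ ψ bi , Recoloured.deg′ ψ bi
    where open Exchange φ feas i j i≢j

  feasible-exists : Fin k → Extendable ∅ → ∃ Feasible
  feasible-exists c₀ ext = total (complete ∅ ext)
    where
    total : (∃ λ τ → ∅ ⊑ τ × Complete τ) → ∃ Feasible
    -- Arcs left uncoloured get the default colour `c₀`; any colour is admissible there, since the
    -- new colouring only has to extend `τ`.
    total (τ , _ , comp) = fromMaybe c₀ ∘ τ , complete⇒feasible comp (cong (fromMaybe c₀))

  feasible-complete : ∀ φ → Feasible φ → ∃ λ τ → (∀ a → Enters T a → τ a ≡ just (φ a)) × Complete τ
  feasible-complete φ feas = unpack (complete (restrict φ) (feasible⇒extendable feas))
    where
    unpack : (∃ λ τ → restrict φ ⊑ τ × Complete τ) → ∃ λ τ → (∀ a → Enters T a → τ a ≡ just (φ a)) × Complete τ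
    unpack (τ , le , comp) = τ , (λ a r → le (restrict-root r)) , comp

-- Assembling the bibranchings

∣tabulate∣ : ∀ {m} (f : Fin m → Bool) {P : Fin m → Set} (P? : Decidable P) →
             (∀ a → f a ≡ true → P a) → (∀ a → P a → f a ≡ true) → ∣ tabulate f ∣ ≡ # P?
∣tabulate∣ {zero} f P? to from = refl
∣tabulate∣ {suc m} f P? to from
  with f zero | P? zero | to zero | from zero | ∣tabulate∣ (f ∘ suc) (P? ∘ suc) (to ∘ suc) (from ∘ suc)
... | true | yes _ | _ | _ | ih = cong suc ih
... | true | no ¬p | t | _ | ih = ⊥-elim (¬p (t refl))
... | false | yes p | _ | g | ih with g p
... | ()
∣tabulate∣ {suc m} f P? to from | false | no _ | _ | _ | ih = ih

cut? : ∀ {m n} (B : Subset m) (X : Subset n) (x y : Fin m → Fin n) → Decidable (λ a → a ∈ B × x a ∈ X × y a ∉ X)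
cut? B X x y a = (a ∈? B) ×-dec (x a ∈? X) ×-dec ¬? (y a ∈? X)

-- With the end maps as parameters, one count covers both `δin` and `δout`.
cut-size : ∀ {m n} (B : Subset m) (X : Subset n) (x y : Fin m → Fin n) →
           ∣ tabulate (λ a → lookup B a ∧ (lookup X (x a) ∧ not (lookup X (y a)))) ∣ ≡ # (cut? B X x y)
cut-size B X x y = ∣tabulate∣ _ (cut? B X x y) to from
  where
  to : ∀ a → lookup B a ∧ (lookup X (x a) ∧ not (lookup X (y a))) ≡ true → a ∈ B × x a ∈ X × y a ∉ X
  to a eq with lookup B a in p | lookup X (x a) in q | lookup X (y a) in r
  to a () | false | _ | _
  to a () | true | false | _
  to a () | true | true | true
  ... | true | true | false = lookup⇒[]= a B p , lookup⇒[]= (x a) X q , λ y∈ → absurd (trans (sym r) ([]=⇒lookup y∈))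
    where
    absurd : false ≢ true
    absurd ()
  from : ∀ a → a ∈ B × x a ∈ X × y a ∉ X → lookup B a ∧ (lookup X (x a) ∧ not (lookup X (y a))) ≡ true
  from a (p , q , r) rewrite []=⇒lookup p | []=⇒lookup q with lookup X (y a) in e
  ... | true = ⊥-elim (r (lookup⇒[]= (y a) X e))
  ... | false = refl

module _ (D : Digraph) where
  open Digraph D

  reach-snoc : ∀ {B u v} a → a ∈ B → Reach D B u v → v ≡ tl a → Reach D B u (hd a)
  reach-snoc a a∈ here refl = step a a∈ refl here
  reach-snoc a a∈ (step e e∈ p r) q = step e e∈ p (reach-snoc a a∈ r q)

  reach-enters : ∀ {B u v} U → u ∉ U → v ∈ U → Reach D B u v → ∃ λ a → a ∈ B × hd a ∈ U × tl a ∉ U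
  reach-enters U u∉ v∈ here = ⊥-elim (u∉ v∈)
  reach-enters U u∉ v∈ (step a a∈ refl r) with hd a ∈? U
  ... | yes h∈ = a , a∈ , h∈ , u∉
  ... | no h∉ = reach-enters U h∉ v∈ r

-- The upper bound and the construction of a packing

module _ (D : Digraph) (S : Subset (Digraph.n D)) (b : Vertex D → ℕ) (bpos : ∀ v → b v > 0) where
  open Digraph D

  floorDiv-≤ : ∀ {x k} v → k ≤ floorDiv D x (b v) (bpos v) → k * b v ≤ x
  floorDiv-≤ {x} {k} v le = ≤-trans (*-monoˡ-≤ (b v) le) (m/n*n≤m x (b v) {{>-nonZero (bpos v)}})

  ≤-floorDiv : ∀ {x k} v → k * b v ≤ x → k ≤ floorDiv D x (b v) (bpos v)
  ≤-floorDiv {x} {k} v le = subst (_≤ floorDiv D x (b v) (bpos v)) (m*n/n≡m k (b v) {{>-nonZero (bpos v)}})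
    (/-monoˡ-≤ (b v) {{>-nonZero (bpos v)}} le)

  -- Weak duality: each of the disjoint members takes its share of every cut considered.
  disjoint-bound : ∀ {j} → HasDisjointBibranchings D S b j → ∀ {k} → CandidateValue D S b bpos k → j ≤ k
  disjoint-bound {j} (F , bib , disj) = bound
    where
    unique : ∀ {c d a} → a ∈ F c → a ∈ F d → c ≡ d
    unique {c} {d} {a} p q = decidable-stable (c ≟ᶠ d) (λ ne → disj c d ne a p q)
    -- The share `r` is the requirement `b v` for a degree bound and 1 for a bicut.
    count : ∀ X (x y : Arc D → Vertex D) r → (∀ c → r ≤ # (cut? (F c) X x y)) → j * r ≤ # (cut? ⊤ X x y)
    count X x y r le = ≤-trans (≤-reflexive (sym (∑-const j r))) (≤-trans (∑-mono le)
      (∑-disjoint (λ c → cut? (F c) X x y) (cut? ⊤ X x y) (λ { (_ , q) → ∈⊤ , q }) (λ p q → unique (proj₁ p) (proj₁ q))))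
    crossed : ∀ U → BicutSet D S U → ∀ c → ∃ λ a → a ∈ F c × hd a ∈ U × tl a ∉ U
    crossed U (inj₁ ((v , v∈) , U⊆T)) c with proj₁ (bib c) v (U⊆T v∈)
    ... | u , u∈ , r = reach-enters D U (λ u∈U → x∈∁p⇒x∉p (U⊆T u∈U) u∈) v∈ r
    crossed U (inj₂ (T⊆U , _ , x , _ , x∉)) c with proj₁ (proj₂ (bib c)) x (x∉∁p⇒x∈p (x∉ ∘ T⊆U))
    ... | v , v∈ , r = reach-enters D U x∉ (T⊆U v∈) r
    bound : ∀ {k} → CandidateValue D S b bpos k → j ≤ k
    bound (inj₁ (v , v∈ , refl)) = ≤-floorDiv v (subst (j * b v ≤_) (sym (cut-size ⊤ ⁅ v ⁆ hd tl))
      (count ⁅ v ⁆ hd tl (b v) (λ c → subst (b v ≤_) (cut-size (F c) ⁅ v ⁆ hd tl) (proj₁ (proj₂ (proj₂ (bib c))) v v∈))))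
    bound (inj₂ (inj₁ (u , u∈ , refl))) = ≤-floorDiv u (subst (j * b u ≤_) (sym (cut-size ⊤ ⁅ u ⁆ tl hd))
      (count ⁅ u ⁆ tl hd (b u) (λ c → subst (b u ≤_) (cut-size (F c) ⁅ u ⁆ tl hd) (proj₂ (proj₂ (proj₂ (bib c))) u u∈))))
    bound (inj₂ (inj₂ (U , bicut , refl))) = subst₂ _≤_ (*-identityʳ j) (sym (cut-size ⊤ U hd tl))
      (count U hd tl 1 (λ c → #-witness (cut? (F c) U hd tl) (proj₁ (crossed U bicut c)) (proj₂ (crossed U bicut c))))

  module Packing (loopless : Loopless D) (s : Vertex D) (s∈S : s ∈ S) (t : Vertex D) (t∈T : t ∈ ∁ S)
                 (k : ℕ) (c₀ : Fin k) (lower : ∀ j → CandidateValue D S b bpos j → k ≤ j) where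

    module T-side = Side tl hd loopless (∁ S) s (x∈p⇒x∉∁p s∈S) b bpos k

    module S-side = Side hd tl (λ a → loopless a ∘ sym) S t (x∈∁p⇒x∉p t∈T) b bpos k

    T-start : T-side.Extendable T-side.∅
    T-start = ∅-extendable
      (λ U ne U⊆T → ≤-trans (lower _ (inj₂ (inj₂ (U , inj₁ (ne , U⊆T) , refl)))) (≤-reflexive (size U)))
      (λ v v∈T → ≤-trans (floorDiv-≤ v (lower _ (inj₁ (v , v∈T , refl)))) (≤-reflexive (size ⁅ v ⁆)))
      where
      open T-side
      size : ∀ U → dIn D ⊤ U ≡ free ∅ U
      size U = trans (cut-size ⊤ U hd tl) (sum-cong-≗ λ a → ⟦⟧-cong (cut? ⊤ U hd tl a) (free? ∅ U a)
        (λ { (_ , en) → refl , en }) (λ { (_ , en) → ∈⊤ , en }))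

    S-start : S-side.Extendable S-side.∅
    S-start = ∅-extendable
      -- The arcs leaving a nonempty `U` inside `S` are those entering its complement, which
      -- contains the other side: a bicut of the second kind.
      (λ U (v , v∈) U⊆S → ≤-trans (lower _ (inj₂ (inj₂ (∁ U , inj₂ (p⊆q⇒∁p⊇∁q U⊆S , (λ _ → ∈⊤) , v , ∈⊤ , x∈p⇒x∉∁p v∈) , refl))))
                                  (≤-reflexive (sizeᶜ U)))
      (λ v v∈S → ≤-trans (floorDiv-≤ v (lower _ (inj₂ (inj₁ (v , v∈S , refl))))) (≤-reflexive (size ⁅ v ⁆)))
      where
      open S-side
      size : ∀ U → dOut D ⊤ U ≡ free ∅ U
      size U = trans (cut-size ⊤ U tl hd) (sum-cong-≗ λ a → ⟦⟧-cong (cut? ⊤ U tl hd a) (free? ∅ U a)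
        (λ { (_ , en) → refl , en }) (λ { (_ , en) → ∈⊤ , en }))
      sizeᶜ : ∀ U → dIn D ⊤ (∁ U) ≡ free ∅ U
      sizeᶜ U = trans (cut-size ⊤ (∁ U) hd tl) (sum-cong-≗ λ a → ⟦⟧-cong (cut? ⊤ (∁ U) hd tl a) (free? ∅ U a)
        (λ { (_ , h , t) → refl , x∉∁p⇒x∈p t , x∈∁p⇒x∉p h }) (λ { (_ , t , h) → ∈⊤ , x∉p⇒x∈∁p h , x∈p⇒x∉∁p t }))

    module Assemble (τ : T-side.State) (τ-complete : T-side.Complete τ)
                    (υ : S-side.State) (υ-complete : S-side.Complete υ)
                    (agree : ∀ a → tl a ∈ S → hd a ∈ ∁ S → τ a ≡ υ a) where

      -- `τ` decides arcs with head in `∁ S` and `υ` arcs with tail in `S`. Both decide the arcs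
      -- from `S` to `∁ S`, where they agree; arcs from `∁ S` to `S` join no class.
      InClass : Fin k → Arc D → Set
      InClass c a = (hd a ∈ ∁ S × τ a ≡ just c) ⊎ (tl a ∈ S × υ a ≡ just c)

      inClass? : ∀ c → Decidable (InClass c)
      inClass? c a = ((hd a ∈? ∁ S) ×-dec (τ a T-side.≟ᵐ just c)) ⊎-dec ((tl a ∈? S) ×-dec (υ a T-side.≟ᵐ just c))

      class : Fin k → ArcSet D
      class c = select (inClass? c)

      fromS : ∀ {c v} → T-side.Reached τ c v → ∃ λ u → u ∈ S × Reach D (class c) u v
      fromS (Side.root v∉) = _ , x∉∁p⇒x∈p v∉ , here
      fromS {c} (Side.arc a eq r) with hd a ∈? ∁ S
      -- A path of `τ` may use arcs with head in `S`, which `τ` does not put in the class; that head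
      -- is itself a valid starting vertex.
      ... | no h∉ = hd a , x∉∁p⇒x∈p h∉ , here
      ... | yes h∈ with fromS r
      ... | u , u∈ , p = u , u∈ , reach-snoc D a (select⁺ (inClass? c) (inj₁ (h∈ , eq))) p refl

      toT : ∀ {c u} → S-side.Reached υ c u → ∃ λ v → v ∈ ∁ S × Reach D (class c) u v
      toT (Side.root u∉) = _ , x∉p⇒x∈∁p u∉ , here
      toT {c} (Side.arc a eq r) with tl a ∈? S
      ... | no t∉ = tl a , x∉p⇒x∈∁p t∉ , here
      ... | yes t∈ with toT r
      ... | v , v∈ , p = v , v∈ , step a (select⁺ (inClass? c) (inj₂ (t∈ , eq))) refl p

      class-bibranching : ∀ c → IsBibranching D S b (class c)
      class-bibranching c =
          (λ v _ → fromS (T-side.Complete.reached τ-complete c v))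
        , (λ u _ → toT (S-side.Complete.reached υ-complete c u))
        , (λ v v∈ → ≤-trans (T-side.Complete.degree≥b τ-complete c v v∈) (≤-trans
            (∑-mono (λ a → ⟦⟧-mono (T-side.indeg? τ c v a) (cut? (class c) ⁅ v ⁆ hd tl a)
              (λ { (eq , en) → select⁺ (inClass? c) (inj₁ (subst (_∈ ∁ S) (sym (x∈⁅y⁆⇒x≡y v (proj₁ en))) v∈ , eq)) , en })))
            (≤-reflexive (sym (cut-size (class c) ⁅ v ⁆ hd tl)))))
        , (λ u u∈ → ≤-trans (S-side.Complete.degree≥b υ-complete c u u∈) (≤-trans
            (∑-mono (λ a → ⟦⟧-mono (S-side.indeg? υ c u a) (cut? (class c) ⁅ u ⁆ tl hd a)
              (λ { (eq , en) → select⁺ (inClass? c) (inj₂ (subst (_∈ S) (sym (x∈⁅y⁆⇒x≡y u (proj₁ en))) u∈ , eq)) , en })))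
            (≤-reflexive (sym (cut-size (class c) ⁅ u ⁆ tl hd)))))

      class-disjoint : ∀ c d → c ≢ d → ∀ a → a ∈ class c → a ∈ class d → ⊥
      class-disjoint c d c≢d a p q = clash (select⁻ (inClass? c) p) (select⁻ (inClass? d) q)
        where
        clash : InClass c a → InClass d a → ⊥
        clash (inj₁ (_ , e)) (inj₁ (_ , e′)) = c≢d (just-injective (trans (sym e) e′))
        clash (inj₂ (_ , e)) (inj₂ (_ , e′)) = c≢d (just-injective (trans (sym e) e′))
        clash (inj₁ (h , e)) (inj₂ (t , e′)) = c≢d (just-injective (trans (sym e) (trans (agree a t h) e′)))
        clash (inj₂ (t , e)) (inj₁ (h , e′)) = c≢d (just-injective (trans (sym e) (trans (sym (agree a t h)) e′)))

    packing : HasDisjointBibranchings D S b k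
    packing = join (T-side.feasible-exists c₀ T-start) (S-side.feasible-exists c₀ S-start)
      where
      join : ∃ T-side.Feasible → ∃ S-side.Feasible → HasDisjointBibranchings D S b k
      join (φ , fφ) (φ′ , fφ′) = finish (common T-side.feasible-exchangeable S-side.feasible-exchangeable φ φ′ fφ fφ′)
        where
        finish : (∃ λ χ → ∃ λ χ′ → T-side.Feasible χ × S-side.Feasible χ′ × (∀ e → χ e ≡ χ′ e)) →
                 HasDisjointBibranchings D S b k
        finish (χ , χ′ , f , f′ , eq) = build (T-side.feasible-complete χ f) (S-side.feasible-complete χ′ f′)
          where
          build : (∃ λ τ → (∀ a → T-side.Enters (∁ S) a → τ a ≡ just (χ a)) × T-side.Complete τ) →
                  (∃ λ υ → (∀ a → S-side.Enters S a → υ a ≡ just (χ′ a)) × S-side.Complete υ) →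
                  HasDisjointBibranchings D S b k
          build (τ , τχ , cτ) (υ , υχ , cυ) = class , class-bibranching , class-disjoint
            where
            open Assemble τ cτ υ cυ (λ a t∈ h∈ → trans (τχ a (h∈ , x∈p⇒x∉∁p t∈))
              (trans (cong just (eq a)) (sym (υχ a (t∈ , x∈∁p⇒x∉p h∈)))))

theorem13 : (D : Digraph) → Loopless D
    → (S : Subset (Digraph.n D)) → Nonempty S → Nonempty (∁ S)
    → (b : Vertex D → ℕ) → (bpos : ∀ v → b v > 0)
    → ∀ k → IsMinimum (CandidateValue D S b bpos) k
    → IsMaximum (HasDisjointBibranchings D S b) k
theorem13 D loopless S (s , s∈S) (t , t∈T) b bpos k (cand , lower) =
  exists k lower , λ j packing → disjoint-bound D S b bpos packing cand
  where
  exists : ∀ k → (∀ j → CandidateValue D S b bpos j → k ≤ j) → HasDisjointBibranchings D S b k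
  -- For `k` equal to 0 the empty family suffices; otherwise `zero` is available as the default
  -- colour.
  exists zero _ = (λ ()) , (λ ()) , λ ()
  exists (suc k) lower = Packing.packing D S b bpos loopless s s∈S t t∈T (suc k) zero lower
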